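{- Let $V=\{2,3,5,\dots\}$ be the set of prime numbers, let $b=\frac rs\in\mathbb{Q}$ with $r,s\in\mathbb{Z}$, $s\ne0$, and let $x\in\mathbb{Q}$. For each $v\in V$ with $|x|_v<1$ and $|b|_v\le1$ define $$F_v(x)=\sum_{n=0}^{\infty}\binom bn x^n=\sum_{n=0}^{\infty}\frac{b(b-1)\cdots(b-n+1)}{n!}x^n\in\mathbb{Q}_v .$$ Suppose that for a fixed prime $v'\in V$ with $|x|_{v'}<1$ and $|b|_{v'}\le1$ one has $F_{v'}(x)=c\in\mathbb{Q}$. Then $F_v(x)\in\mathbb{Q}$ for every prime $v\in V$ with $|x|_v<1$ and $|b|_v\le1$ for which $|\pm c-1|_v<1$ is satisfied (i.e. $|c-1|_v<1$ or $|-c-1|_v<1$).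
   Context: For a prime $v$, $\mathbb{Q}_v$ is the field of $v$-adic numbers and $|\cdot|_v$ the $v$-adic absolute value, normalized by $|v|_v=1/v$; the series defining $F_v(x)$ is summed in $\mathbb{Q}_v$. The $n=0$ coefficient of the series is $1$. -}

module Defs where

open import Data.Nat.Base as ℕ using (ℕ; zero; suc; _!; z≤n; s≤s)
import Data.Nat.Properties as ℕ
open import Data.Nat.Divisibility
  using (_∣_; _∤_; _∣?_; divides; ∣-trans; ∣1⇒≡1; ∣n⇒∣m*n; m∣m*n; *-cancelˡ-∣)
open import Data.Nat.Coprimality as Coprimality
  using (Coprime; coprime-divisor; coprime-Bézout; recompute)
open import Data.Nat.GCD using (module Bézout)
open import Data.Nat.Primality
  using (Prime; prime⇒nonZero; prime⇒nonTrivial; prime⇒irreducible; euclidsLemma)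
open import Data.Integer.Base as ℤ using (ℤ; +_; +[1+_]; -[1+_]; 0ℤ; 1ℤ)
import Data.Integer.Properties as ℤ
import Data.Integer.DivMod as ℤ
import Data.Sign.Base as Sign
import Data.Integer.Tactic.RingSolver as ℤ-Ring
open import Data.Product.Base using (∃; ∃-syntax; _×_; _,_; proj₁; proj₂)
open import Data.Rational.Base as ℚ
  using (ℚ; mkℚ; 0ℚ; 1ℚ; _+_; _*_; _-_; -_; _÷_; _/_; _<_; _≤_; ↥_; ↧_; ↧ₙ_)
import Data.Rational.Properties as ℚ
open import Data.Rational.Literals using (fromℤ)
open import Data.Rational.Unnormalised.Base as ℚᵘ using (mkℚᵘ)
import Data.Rational.Unnormalised.Properties as ℚᵘ
open import Data.Rational.Solver using (module +-*-Solver)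
open import Data.Sum.Base using (_⊎_; inj₁; inj₂; [_,_]′)
open import Algebra.Definitions.RawSemiring ℚ.+-*-rawSemiring using (_^_)
open import Relation.Binary.PropositionalEquality
open import Relation.Nullary.Decidable using (decidable-stable)
open import Relation.Nullary using (¬_; yes; no; contradiction)

open +-*-Solver using (solve; _:=_; _:+_; _:*_; :-_; _:-_)

V : Set
V = ∃ Prime

-- The exponent of p in n, for p ≥ 2 and 1 ≤ n ≤ fuel.
ordWithin : (fuel p n : ℕ) → ℕ
ordWithin zero       p n = 0
ordWithin (suc fuel) p n with p ∣? n
... | yes (divides q _) = suc (ordWithin fuel p q)
... | no  _             = 0

ord : (p n : ℕ) → ℕ
ord p n = ordWithin n p n

-- ∣ n / d ∣ for n / d in lowest terms.
absFraction : V → (n d : ℕ) → ℚ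
absFraction _        zero      d = 0ℚ
absFraction (p , pr) n@(suc _) d = + (p ℕ.^ ord p d) / (p ℕ.^ ord p n)
  where
  instance
    p≢0  = prime⇒nonZero pr
    pᵏ≢0 = ℕ.m^n≢0 p (ord p n)

∣_∣[_] : ℚ → V → ℚ
∣ q ∣[ v ] = absFraction v ℤ.∣ ↥ q ∣ (↧ₙ q)

-- ℚ_v is the completion of ℚ with respect to ∣_∣[ v ]: Cauchy sequences of
-- rationals, two of them being identified (by _≈_) when their difference
-- tends to 0.
record ℚ⟨_⟩ (v : V) : Set where
  constructor completion
  field
    seq    : ℕ → ℚ
    cauchy : ∀ ε → 0ℚ < ε → ∃[ N ] ∀ m n → N ℕ.≤ m → N ℕ.≤ n →
             ∣ seq m - seq n ∣[ v ] < ε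

open ℚ⟨_⟩ public

module _ {v : V} where

  -- Eventual closeness of representatives: it implies that the v-adic
  -- distance is at most ε, and is implied by it being less than ε.
  Within : ℚ → ℚ⟨ v ⟩ → ℚ⟨ v ⟩ → Set
  Within ε α β = ∃[ N ] ∀ n → N ℕ.≤ n → ∣ seq α n - seq β n ∣[ v ] < ε

  infix 4 _≈_
  _≈_ : ℚ⟨ v ⟩ → ℚ⟨ v ⟩ → Set
  α ≈ β = ∀ ε → 0ℚ < ε → Within ε α β

  infix 4 _⟶_
  _⟶_ : (ℕ → ℚ⟨ v ⟩) → ℚ⟨ v ⟩ → Set
  u ⟶ α = ∀ ε → 0ℚ < ε → ∃[ N ] ∀ n → N ℕ.≤ n → Within ε (u n) α

  ι : ℚ → ℚ⟨ v ⟩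
  ι q = completion (λ _ → q) λ ε ε>0 → 0 , λ _ _ _ _ →
    subst (λ z → ∣ z ∣[ v ] < ε) (sym (ℚ.+-inverseʳ q)) ε>0

  IsRational : ℚ⟨ v ⟩ → Set
  IsRational α = ∃[ q ] α ≈ ι q

falling : ℚ → ℕ → ℚ
falling b zero    = 1ℚ
falling b (suc n) = falling b n * (b - fromℤ (+ n))

binom : ℚ → ℕ → ℚ
binom b n = falling b n ÷ fromℤ (+ (n !))
  where instance n!≢0 = n ℕ.!≢0

term : (b x : ℚ) → ℕ → ℚ
term b x n = binom b n * x ^ n

partialSum : (ℕ → ℚ) → ℕ → ℚ
partialSum a zero    = 0ℚ
partialSum a (suc n) = partialSum a n + a n

fromℤ-* : ∀ i j → fromℤ (i ℤ.* j) ≡ fromℤ i * fromℤ j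
fromℤ-* i j = sym (ℚ.↥p/↧p≡p (fromℤ (i ℤ.* j)))

fromℤ-+ : ∀ i j → fromℤ (i ℤ.+ j) ≡ fromℤ i + fromℤ j
fromℤ-+ i j = trans (sym (ℚ.↥p/↧p≡p (fromℤ (i ℤ.+ j))))
  (cong (_/ 1) (sym (cong₂ ℤ._+_ (ℤ.*-identityʳ i) (ℤ.*-identityʳ j))))

fromℤ-neg : ∀ i → fromℤ (ℤ.- i) ≡ - fromℤ i
fromℤ-neg (+ 0)    = refl
fromℤ-neg +[1+ _ ] = refl
fromℤ-neg -[1+ _ ] = refl

fromℤ-- : ∀ i j → fromℤ (i ℤ.- j) ≡ fromℤ i - fromℤ j
fromℤ-- i j = trans (fromℤ-+ i (ℤ.- j)) (cong (λ z → fromℤ i + z) (fromℤ-neg j))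

*-cancelʳ-≡ : ∀ {p q} r .{{_ : ℚ.NonZero r}} → p * r ≡ q * r → p ≡ q
*-cancelʳ-≡ {p} {q} r eq = begin
  p                  ≡⟨ ℚ.*-identityʳ p ⟨
  p * 1ℚ             ≡⟨ cong (p *_) (ℚ.*-inverseʳ r) ⟨
  p * (r * ℚ.1/ r)   ≡⟨ ℚ.*-assoc p r _ ⟨
  p * r * ℚ.1/ r     ≡⟨ cong (_* ℚ.1/ r) eq ⟩
  q * r * ℚ.1/ r     ≡⟨ ℚ.*-assoc q r _ ⟩
  q * (r * ℚ.1/ r)   ≡⟨ cong (q *_) (ℚ.*-inverseʳ r) ⟩
  q * 1ℚ             ≡⟨ ℚ.*-identityʳ q ⟩
  q                  ∎
  where open ≡-Reasoning

↥≡*↧ : ∀ q → q * fromℤ (↧ q) ≡ fromℤ (↥ q)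
↥≡*↧ q@(mkℚ n d _) = ℚ.toℚᵘ-injective (ℚᵘ.≃-trans
  (ℚ.toℚᵘ-homo-* q (fromℤ (↧ q)))
  (ℚᵘ.*≡* (trans (ℤ.*-identityʳ _) (cong (λ k → n ℤ.* + k) (sym (ℕ.*-identityʳ (suc d)))))))

↥⊥↧ : ∀ q → Coprime ℤ.∣ ↥ q ∣ (↧ₙ q)
↥⊥↧ (mkℚ _ _ c) = recompute c

swapʳ : ∀ a b c → a * b * c ≡ a * c * b
swapʳ = solve 3 (λ a b c → a :* b :* c := a :* c :* b) refl

exchange : ∀ a b c d → a * b * (c * d) ≡ a * c * (b * d)
exchange = solve 4 (λ a b c d → a :* b :* (c :* d) := a :* c :* (b :* d)) refl

cross : ∀ a b c d → (a + b) * (c * d) ≡ a * c * d + b * d * c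
cross = solve 4 (λ a b c d → (a :+ b) :* (c :* d) := a :* c :* d :+ b :* d :* c) refl

/≤1⇒≤ : ∀ a b .{{_ : ℕ.NonZero b}} → + a / b ≤ 1ℚ → a ℕ.≤ b
/≤1⇒≤ a b@(suc b-1) le = ℤ.drop‿+≤+ (subst₂ ℤ._≤_ (ℤ.*-identityʳ (+ a)) (ℤ.*-identityˡ (+ b))
  (ℚᵘ.drop-*≤* (ℚᵘ.≤-respˡ-≃ (ℚ.toℚᵘ-fromℚᵘ (mkℚᵘ (+ a) b-1)) (ℚ.toℚᵘ-mono-≤ le))))

/<1⇒< : ∀ a b .{{_ : ℕ.NonZero b}} → + a / b < 1ℚ → a ℕ.< b
/<1⇒< a b@(suc b-1) lt = ℤ.drop‿+<+ (subst₂ ℤ._<_ (ℤ.*-identityʳ (+ a)) (ℤ.*-identityˡ (+ b))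
  (ℚᵘ.drop-*<* (ℚᵘ.<-respˡ-≃ (ℚ.toℚᵘ-fromℚᵘ (mkℚᵘ (+ a) b-1)) (ℚ.toℚᵘ-mono-< lt))))

1/-small : ∀ ε → 0ℚ < ε → ∀ b .{{_ : ℕ.NonZero b}} → ↧ₙ ε ℕ.< b → + 1 / b < ε
1/-small (mkℚ (+ 0) d _)        (ℚ.*<* (ℤ.+<+ ())) _ _
1/-small (mkℚ -[1+ n ] d _)     (ℚ.*<* ()) _ _
1/-small ε@(mkℚ +[1+ n ] d c) ε>0 b@(suc b-1) d<b =
  ℚ.toℚᵘ-cancel-< (ℚᵘ.<-respˡ-≃ (ℚᵘ.≃-sym (ℚ.toℚᵘ-fromℚᵘ (mkℚᵘ (+ 1) b-1)))
    (ℚᵘ.*<* (ℤ.+<+ (ℕ.<-≤-trans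
      (subst (ℕ._< b) (sym (ℕ.*-identityˡ (suc d))) d<b)
      (ℕ.m≤m+n b (n ℕ.* b))))))

progression : ℤ → ℤ → ℕ → ℤ
progression m d zero    = 1ℤ
progression m d (suc n) = progression m d n ℤ.* (m ℤ.- + n ℤ.* d)

falling-progression : ∀ b m d n → b * fromℤ (+ d) ≡ fromℤ m →
  falling b n * fromℤ (+ (d ℕ.^ n)) ≡ fromℤ (progression m (+ d) n)
falling-progression b m d zero    eq = ℚ.*-identityˡ _
falling-progression b m d (suc n) eq = begin
  falling b n * (b - N) * fromℤ (+ (d ℕ.* d ℕ.^ n))
    ≡⟨ cong (λ t → falling b n * (b - N) * t)
         (trans (cong fromℤ (ℤ.pos-* d (d ℕ.^ n))) (fromℤ-* (+ d) (+ (d ℕ.^ n)))) ⟩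
  falling b n * (b - N) * (D * Dⁿ)
    ≡⟨ regroup (falling b n) b N D Dⁿ ⟩
  falling b n * Dⁿ * (b * D - N * D)
    ≡⟨ cong₂ (λ s t → s * (t - N * D)) (falling-progression b m d n eq) eq ⟩
  fromℤ A * (fromℤ m - N * D)
    ≡⟨ cong (λ t → fromℤ A * (fromℤ m - t)) (fromℤ-* (+ n) (+ d)) ⟨
  fromℤ A * (fromℤ m - fromℤ (+ n ℤ.* + d))
    ≡⟨ cong (λ t → fromℤ A * t) (fromℤ-- m (+ n ℤ.* + d)) ⟨
  fromℤ A * fromℤ (m ℤ.- + n ℤ.* + d)
    ≡⟨ fromℤ-* A (m ℤ.- + n ℤ.* + d) ⟨
  fromℤ (A ℤ.* (m ℤ.- + n ℤ.* + d)) ∎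
  where
  open ≡-Reasoning
  N  = fromℤ (+ n)
  D  = fromℤ (+ d)
  Dⁿ = fromℤ (+ (d ℕ.^ n))
  A  = progression m (+ d) n
  regroup : ∀ f b N D E → f * (b - N) * (D * E) ≡ f * E * (b * D - N * D)
  regroup = solve 5 (λ f b N D E → f :* (b :- N) :* (D :* E) := f :* E :* (b :* D :- N :* D)) refl

progression-cong : ∀ M e m d n →
  ∃[ z ] progression (m ℤ.+ M ℤ.* e) d n ≡ progression m d n ℤ.+ M ℤ.* z
progression-cong M e m d zero    = 0ℤ , sym (cong (λ t → 1ℤ ℤ.+ t) (ℤ.*-zeroʳ M))
progression-cong M e m d (suc n) =
  let z , eq = progression-cong M e m d n in
  progression m d n ℤ.* e ℤ.+ z ℤ.* (m ℤ.+ M ℤ.* e ℤ.- + n ℤ.* d) ,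
  trans (cong (ℤ._* (m ℤ.+ M ℤ.* e ℤ.- + n ℤ.* d)) eq)
        (expand (progression m d n) M z m e (+ n ℤ.* d))
  where
  expand : ∀ A M z m e t → (A ℤ.+ M ℤ.* z) ℤ.* (m ℤ.+ M ℤ.* e ℤ.- t) ≡
    A ℤ.* (m ℤ.- t) ℤ.+ M ℤ.* (A ℤ.* e ℤ.+ z ℤ.* (m ℤ.+ M ℤ.* e ℤ.- t))
  expand = ℤ-Ring.solve-∀

progression-scale : ∀ d B n →
  progression (+ d ℤ.* B) (+ d) n ≡ + (d ℕ.^ n) ℤ.* progression B 1ℤ n
progression-scale d B zero    = refl
progression-scale d B (suc n) = begin
  progression (+ d ℤ.* B) (+ d) n ℤ.* (+ d ℤ.* B ℤ.- + n ℤ.* + d)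
    ≡⟨ cong (ℤ._* (+ d ℤ.* B ℤ.- + n ℤ.* + d)) (progression-scale d B n) ⟩
  + (d ℕ.^ n) ℤ.* A ℤ.* (+ d ℤ.* B ℤ.- + n ℤ.* + d)
    ≡⟨ regroup (+ (d ℕ.^ n)) A (+ d) B (+ n) ⟩
  + d ℤ.* + (d ℕ.^ n) ℤ.* (A ℤ.* (B ℤ.- + n ℤ.* 1ℤ))
    ≡⟨ cong (ℤ._* (A ℤ.* (B ℤ.- + n ℤ.* 1ℤ))) (ℤ.pos-* d (d ℕ.^ n)) ⟨
  + (d ℕ.^ suc n) ℤ.* (A ℤ.* (B ℤ.- + n ℤ.* 1ℤ)) ∎
  where
  open ≡-Reasoning
  A = progression B 1ℤ n
  regroup : ∀ E A D B N → E ℤ.* A ℤ.* (D ℤ.* B ℤ.- N ℤ.* D) ≡ D ℤ.* E ℤ.* (A ℤ.* (B ℤ.- N ℤ.* 1ℤ))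
  regroup = ℤ-Ring.solve-∀

progression-shift : ∀ B n →
  progression (1ℤ ℤ.+ B) 1ℤ (suc n) ≡ (1ℤ ℤ.+ B) ℤ.* progression B 1ℤ n
progression-shift B zero    = base B
  where
  base : ∀ B → 1ℤ ℤ.* (1ℤ ℤ.+ B ℤ.- 0ℤ ℤ.* 1ℤ) ≡ (1ℤ ℤ.+ B) ℤ.* 1ℤ
  base = ℤ-Ring.solve-∀
progression-shift B (suc n) =
  trans (cong (ℤ._* (1ℤ ℤ.+ B ℤ.- + suc n ℤ.* 1ℤ)) (progression-shift B n))
        (step B (progression B 1ℤ n) (+ n))
  where
  step : ∀ B A N → (1ℤ ℤ.+ B) ℤ.* A ℤ.* (1ℤ ℤ.+ B ℤ.- (1ℤ ℤ.+ N) ℤ.* 1ℤ) ≡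
    (1ℤ ℤ.+ B) ℤ.* (A ℤ.* (B ℤ.- N ℤ.* 1ℤ))
  step = ℤ-Ring.solve-∀

progression-0 : ∀ n → progression 0ℤ 1ℤ (suc n) ≡ 0ℤ
progression-0 zero    = refl
progression-0 (suc n) = cong (ℤ._* (0ℤ ℤ.- + suc n ℤ.* 1ℤ)) (progression-0 n)

!∣progression : ∀ B n → ∃[ z ] progression (+ B) 1ℤ n ≡ + (n !) ℤ.* z
!∣progression zero    zero    = 1ℤ , refl
!∣progression zero    (suc n) = 0ℤ , trans (progression-0 n) (sym (ℤ.*-zeroʳ (+ (suc n !))))
!∣progression (suc B) zero    = 1ℤ , refl
!∣progression (suc B) (suc n) =
  let z  , eq  = !∣progression B (suc n)
      z′ , eq′ = !∣progression B n
  in z ℤ.+ z′ , (begin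
  progression (+ suc B) 1ℤ (suc n)
    ≡⟨ progression-shift (+ B) n ⟩
  (1ℤ ℤ.+ + B) ℤ.* A
    ≡⟨ pascal (+ B) A (+ n) ⟩
  A ℤ.* (+ B ℤ.- + n ℤ.* 1ℤ) ℤ.+ + suc n ℤ.* A
    ≡⟨ cong₂ (λ s t → s ℤ.+ + suc n ℤ.* t) eq eq′ ⟩
  + (suc n !) ℤ.* z ℤ.+ + suc n ℤ.* (+ (n !) ℤ.* z′)
    ≡⟨ cong (λ t → + (suc n !) ℤ.* z ℤ.+ t)
         (trans (sym (ℤ.*-assoc (+ suc n) (+ (n !)) z′)) (cong (ℤ._* z′) (sym (ℤ.pos-* (suc n) (n !))))) ⟩
  + (suc n !) ℤ.* z ℤ.+ + (suc n !) ℤ.* z′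
    ≡⟨ ℤ.*-distribˡ-+ (+ (suc n !)) z z′ ⟨
  + (suc n !) ℤ.* (z ℤ.+ z′) ∎)
  where
  open ≡-Reasoning
  A = progression (+ B) 1ℤ n
  pascal : ∀ B A N → (1ℤ ℤ.+ B) ℤ.* A ≡ A ℤ.* (B ℤ.- N ℤ.* 1ℤ) ℤ.+ (1ℤ ℤ.+ N) ℤ.* A
  pascal = ℤ-Ring.solve-∀

inverseMod : ∀ d P → Coprime d P → ∃[ t ] ∃[ u ] + d ℤ.* t ≡ 1ℤ ℤ.+ + P ℤ.* u
inverseMod d P cop = fromBézout (coprime-Bézout cop)
  where
  fromBézout : Bézout.Identity 1 d P → ∃[ t ] ∃[ u ] + d ℤ.* t ≡ 1ℤ ℤ.+ + P ℤ.* u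
  fromBézout (Bézout.+- x y eq) = + x , + y ,
    trans (trans (sym (ℤ.pos-* d x)) (cong +_ (trans (ℕ.*-comm d x) (trans (sym eq) (cong suc (ℕ.*-comm y P))))))
          (cong (λ t → 1ℤ ℤ.+ t) (ℤ.pos-* P y))
  fromBézout (Bézout.-+ x y eq) = ℤ.- + x , ℤ.- + y , move (+ d) (+ x) (+ P) (+ y)
    (trans (cong (λ t → 1ℤ ℤ.+ t) (sym (ℤ.pos-* x d))) (trans (cong +_ eq) (ℤ.pos-* y P)))
    where
    lhs : ∀ d x → d ℤ.* (ℤ.- x) ≡ 1ℤ ℤ.- (1ℤ ℤ.+ x ℤ.* d)
    lhs = ℤ-Ring.solve-∀
    rhs : ∀ P y → 1ℤ ℤ.- y ℤ.* P ≡ 1ℤ ℤ.+ P ℤ.* (ℤ.- y)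
    rhs = ℤ-Ring.solve-∀
    move : ∀ d x P y → 1ℤ ℤ.+ x ℤ.* d ≡ y ℤ.* P → d ℤ.* (ℤ.- x) ≡ 1ℤ ℤ.+ P ℤ.* (ℤ.- y)
    move d x P y e = trans (lhs d x) (trans (cong (λ t → 1ℤ ℤ.- t) e) (rhs P y))

approximate : ∀ m d P .{{_ : ℕ.NonZero P}} → Coprime d P →
  ∃[ B ] ∃[ e ] m ≡ + d ℤ.* + B ℤ.+ + P ℤ.* e
approximate m d P cop =
  let t , u , eq = inverseMod d P cop
      a = t ℤ.* m
      q = a ℤ./ℕ P
      B = a ℤ.%ℕ P
  in B , + d ℤ.* q ℤ.- m ℤ.* u , (begin
  m                                             ≡⟨ isolate m (+ P) u ⟩
  (1ℤ ℤ.+ + P ℤ.* u) ℤ.* m ℤ.- + P ℤ.* (m ℤ.* u) ≡⟨ cong (λ s → s ℤ.* m ℤ.- + P ℤ.* (m ℤ.* u)) eq ⟨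
  + d ℤ.* t ℤ.* m ℤ.- + P ℤ.* (m ℤ.* u)          ≡⟨ cong (ℤ._- + P ℤ.* (m ℤ.* u)) (ℤ.*-assoc (+ d) t m) ⟩
  + d ℤ.* a ℤ.- + P ℤ.* (m ℤ.* u)                ≡⟨ cong (λ s → + d ℤ.* s ℤ.- + P ℤ.* (m ℤ.* u)) (ℤ.a≡a%ℕn+[a/ℕn]*n a P) ⟩
  + d ℤ.* (+ B ℤ.+ q ℤ.* + P) ℤ.- + P ℤ.* (m ℤ.* u) ≡⟨ collect (+ d) (+ B) q (+ P) (m ℤ.* u) ⟩
  + d ℤ.* + B ℤ.+ + P ℤ.* (+ d ℤ.* q ℤ.- m ℤ.* u) ∎)
  where
  open ≡-Reasoning
  isolate : ∀ m P u → m ≡ (1ℤ ℤ.+ P ℤ.* u) ℤ.* m ℤ.- P ℤ.* (m ℤ.* u)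
  isolate = ℤ-Ring.solve-∀
  collect : ∀ d B q P w → d ℤ.* (B ℤ.+ q ℤ.* P) ℤ.- P ℤ.* w ≡ d ℤ.* B ℤ.+ P ℤ.* (d ℤ.* q ℤ.- w)
  collect = ℤ-Ring.solve-∀

∣progression : ∀ m d n P u .{{_ : ℕ.NonZero P}} → Coprime d P → n ! ≡ P ℕ.* u →
  ∃[ z ] progression m (+ d) n ≡ + P ℤ.* z
∣progression m d n P u cop n!≡Pu =
  let B , e , m≡ = approximate m d P cop
      z  , eq    = progression-cong (+ P) e (+ d ℤ.* + B) (+ d) n
      z′ , eq′   = !∣progression B n
  in + (d ℕ.^ n) ℤ.* (+ u ℤ.* z′) ℤ.+ z , (begin
  progression m (+ d) n
    ≡⟨ cong (λ t → progression t (+ d) n) m≡ ⟩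
  progression (+ d ℤ.* + B ℤ.+ + P ℤ.* e) (+ d) n
    ≡⟨ eq ⟩
  progression (+ d ℤ.* + B) (+ d) n ℤ.+ + P ℤ.* z
    ≡⟨ cong (ℤ._+ + P ℤ.* z) (progression-scale d (+ B) n) ⟩
  + (d ℕ.^ n) ℤ.* progression (+ B) 1ℤ n ℤ.+ + P ℤ.* z
    ≡⟨ cong (λ t → + (d ℕ.^ n) ℤ.* t ℤ.+ + P ℤ.* z)
         (trans eq′ (cong (ℤ._* z′) (trans (cong +_ n!≡Pu) (ℤ.pos-* P u)))) ⟩
  + (d ℕ.^ n) ℤ.* (+ P ℤ.* + u ℤ.* z′) ℤ.+ + P ℤ.* z
    ≡⟨ collect (+ (d ℕ.^ n)) (+ P) (+ u) z′ z ⟩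
  + P ℤ.* (+ (d ℕ.^ n) ℤ.* (+ u ℤ.* z′) ℤ.+ z) ∎)
  where
  open ≡-Reasoning
  collect : ∀ D P u z′ z → D ℤ.* (P ℤ.* u ℤ.* z′) ℤ.+ P ℤ.* z ≡ P ℤ.* (D ℤ.* (u ℤ.* z′) ℤ.+ z)
  collect = ℤ-Ring.solve-∀

binom*! : ∀ b n → binom b n * fromℤ (+ (n !)) ≡ falling b n
binom*! b n = trans (ℚ.*-assoc (falling b n) _ _)
  (trans (cong (λ t → falling b n * t) (ℚ.*-inverseˡ (fromℤ (+ (n !)))))
         (ℚ.*-identityʳ (falling b n)))
  where instance n!≢0 = n ℕ.!≢0

module _ (v : V) where

  private
    p  = proj₁ v
    pr = proj₂ v

    instance
      p≢0 : ℕ.NonZero p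
      p≢0 = prime⇒nonZero pr

      p>1 : ℕ.NonTrivial p
      p>1 = prime⇒nonTrivial pr

    pᵏ≢0 : ∀ k → ℕ.NonZero (p ℕ.^ k)
    pᵏ≢0 k = ℕ.m^n≢0 p k

  k<pᵏ : ∀ k → k ℕ.< p ℕ.^ k
  k<pᵏ zero    = s≤s z≤n
  k<pᵏ (suc k) = ℕ.≤-<-trans (k<pᵏ k)
    (subst (p ℕ.^ k ℕ.<_) (ℕ.*-comm (p ℕ.^ k) p)
      (ℕ.m<m*n (p ℕ.^ k) p {{pᵏ≢0 k}} (ℕ.nonTrivial⇒n>1 p)))

  p∤1 : p ∤ 1
  p∤1 p∣1 = ℕ.nonTrivial⇒≢1 (∣1⇒≡1 p∣1)

  ∤-* : ∀ {m n} → p ∤ m → p ∤ n → p ∤ m ℕ.* n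
  ∤-* {m} {n} p∤m p∤n p∣mn = [ p∤m , p∤n ]′ (euclidsLemma m n pr p∣mn)

  ∤-^ : ∀ {m} k → p ∤ m → p ∤ m ℕ.^ k
  ∤-^ zero    p∤m = p∤1
  ∤-^ (suc k) p∤m = ∤-* p∤m (∤-^ k p∤m)

  ordWithin-spec : ∀ f n .{{_ : ℕ.NonZero n}} → n ℕ.≤ f →
    ∃[ m ] n ≡ p ℕ.^ ordWithin f p n ℕ.* m × p ∤ m
  ordWithin-spec zero    (suc _) ()
  ordWithin-spec (suc f) n n≤1+f with p ∣? n
  ... | no p∤n = n , sym (ℕ.*-identityˡ n) , p∤n
  ... | yes (divides zero eq) = contradiction eq (ℕ.≢-nonZero⁻¹ n)
  ... | yes (divides q@(suc _) eq) with
        ordWithin-spec f q (ℕ.≤-pred (ℕ.≤-trans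
          (subst (q ℕ.<_) (sym eq) (ℕ.m<m*n q p (ℕ.nonTrivial⇒n>1 p))) n≤1+f))
  ...   | m , eq′ , p∤m = m , trans eq (trans (ℕ.*-comm q p)
            (trans (cong (p ℕ.*_) eq′) (sym (ℕ.*-assoc p _ m)))) , p∤m

  ord-spec : ∀ n .{{_ : ℕ.NonZero n}} → ∃[ m ] n ≡ p ℕ.^ ord p n ℕ.* m × p ∤ m
  ord-spec n = ordWithin-spec n n ℕ.≤-refl

  p^≤⇒∣ : ∀ {j k} → j ℕ.≤ k → p ℕ.^ j ∣ p ℕ.^ k
  p^≤⇒∣ {j} {k} j≤k = subst (p ℕ.^ j ∣_)
    (trans (sym (ℕ.^-distribˡ-+-* p j (k ℕ.∸ j))) (cong (p ℕ.^_) (ℕ.m+[n∸m]≡n j≤k)))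
    (m∣m*n (p ℕ.^ (k ℕ.∸ j)))

  ∣⇒≤ord : ∀ {k} n .{{_ : ℕ.NonZero n}} → p ℕ.^ k ∣ n → k ℕ.≤ ord p n
  ∣⇒≤ord {k} n pᵏ∣n with ord-spec n
  ... | m , eq , p∤m with k ℕ.≤? ord p n
  ...   | yes k≤o = k≤o
  ...   | no  k≰o = contradiction
            (*-cancelˡ-∣ (p ℕ.^ ord p n) {{pᵏ≢0 (ord p n)}}
              (subst₂ _∣_ (ℕ.*-comm p _) eq (∣-trans (p^≤⇒∣ (ℕ.≰⇒> k≰o)) pᵏ∣n)))
            p∤m

  ∤⇒ord≡0 : ∀ n → p ∤ n → ord p n ≡ 0
  ∤⇒ord≡0 zero    p∤n = refl
  ∤⇒ord≡0 n@(suc _) p∤n with p ∣? n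
  ... | yes p∣n = contradiction p∣n p∤n
  ... | no  _   = refl

  ∤⇒coprime : ∀ {n} → p ∤ n → Coprime p n
  ∤⇒coprime p∤n {d} (d∣p , d∣n) with prime⇒irreducible pr d∣p
  ... | inj₁ d≡1 = d≡1
  ... | inj₂ refl = contradiction d∣n p∤n

  ∤⇒coprime^ : ∀ {n} k → p ∤ n → Coprime n (p ℕ.^ k)
  ∤⇒coprime^ zero    p∤n (_ , d∣1) = ∣1⇒≡1 d∣1
  ∤⇒coprime^ (suc k) p∤n {d} (d∣n , d∣pᵏ) = ∤⇒coprime^ k p∤n
    (d∣n , coprime-divisor (λ { (e∣d , e∣p) → ∤⇒coprime p∤n (e∣p , ∣-trans e∣d d∣n) }) d∣pᵏ)

  absFraction≤1⇒∤ : ∀ n d .{{_ : ℕ.NonZero d}} → Coprime n d → absFraction v n d ≤ 1ℚ → p ∤ d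
  absFraction≤1⇒∤ zero      d cop le p∣d = p∤1 (subst (p ∣_) (cop (divides 0 refl , divides 1 (sym (ℕ.*-identityˡ d)))) p∣d)
  absFraction≤1⇒∤ n@(suc _) d cop le p∣d = ℕ.<-irrefl refl (ℕ.<-≤-trans 1<p^ord p^ord≤1)
    where
    p∤n : p ∤ n
    p∤n p∣n = ℕ.nonTrivial⇒≢1 (cop (p∣n , p∣d))

    p^ord≤1 : p ℕ.^ ord p d ℕ.≤ 1
    p^ord≤1 = subst (λ k → p ℕ.^ ord p d ℕ.≤ p ℕ.^ k) (∤⇒ord≡0 n p∤n)
      (/≤1⇒≤ (p ℕ.^ ord p d) (p ℕ.^ ord p n) {{pᵏ≢0 (ord p n)}} le)

    1<p^ord : 1 ℕ.< p ℕ.^ ord p d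
    1<p^ord = ℕ.≤-<-trans (∣⇒≤ord {1} d (subst (_∣ d) (sym (ℕ.*-identityʳ p)) p∣d)) (k<pᵏ (ord p d))

  absFraction<1⇒∣ : ∀ n d → absFraction v n d < 1ℚ → p ∣ n
  absFraction<1⇒∣ zero      d lt = divides 0 refl
  absFraction<1⇒∣ n@(suc _) d lt = decidable-stable (p ∣? n) λ p∤n →
    contradiction
      (subst (λ k → p ℕ.^ ord p d ℕ.< p ℕ.^ k) (∤⇒ord≡0 n p∤n)
        (/<1⇒< (p ℕ.^ ord p d) (p ℕ.^ ord p n) {{pᵏ≢0 (ord p n)}} lt))
      (ℕ.≤⇒≯ (ℕ.m^n>0 p (ord p d)))

  ∣≤1⇒∤↧ : ∀ q → ∣ q ∣[ v ] ≤ 1ℚ → p ∤ ↧ₙ q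
  ∣≤1⇒∤↧ (mkℚ n d c) = absFraction≤1⇒∤ ℤ.∣ n ∣ (suc d) (recompute c)

  -- q ∈ v^k ℤ_(v)
  record Divisible (k : ℕ) (q : ℚ) : Set where
    constructor divisible
    field
      cofactor  : ℕ
      multiple  : ℤ
      p∤cofactor : p ∤ cofactor
      equality  : q * fromℤ (+ cofactor) ≡ fromℤ (+ (p ℕ.^ k) ℤ.* multiple)

  open Divisible

  Divisible⇒ℕ : ∀ {k q} (d : Divisible k q) →
    ℤ.∣ ↥ q ∣ ℕ.* cofactor d ≡ p ℕ.^ k ℕ.* ℤ.∣ multiple d ∣ ℕ.* ↧ₙ q
  Divisible⇒ℕ {k} {q} (divisible w z p∤w eq) = begin
    ℤ.∣ i ∣ ℕ.* w                       ≡⟨ ℤ.abs-* i (+ w) ⟨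
    ℤ.∣ i ℤ.* + w ∣                     ≡⟨ cong ℤ.∣_∣ (cong ↥_ rat-eq) ⟩
    ℤ.∣ P ℤ.* z ℤ.* + d ∣               ≡⟨ ℤ.abs-* (P ℤ.* z) (+ d) ⟩
    ℤ.∣ P ℤ.* z ∣ ℕ.* d                 ≡⟨ cong (ℕ._* d) (ℤ.abs-* P z) ⟩
    p ℕ.^ k ℕ.* ℤ.∣ z ∣ ℕ.* d           ∎
    where
    open ≡-Reasoning
    i = ↥ q
    d = ↧ₙ q
    P = + (p ℕ.^ k)
    rat-eq : fromℤ (i ℤ.* + w) ≡ fromℤ (P ℤ.* z ℤ.* + d)
    rat-eq = trans (fromℤ-* i (+ w))
      (trans (cong (λ t → t * fromℤ (+ w)) (sym (↥≡*↧ q)))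
      (trans (swapʳ q (fromℤ (+ d)) (fromℤ (+ w)))
      (trans (cong (λ t → t * fromℤ (+ d)) eq)
      (sym (fromℤ-* (P ℤ.* z) (+ d))))))

  pᵃ/-small : ∀ ε → 0ℚ < ε → ∀ a b .{{_ : ℕ.NonZero b}} → a ≡ 0 → ↧ₙ ε ℕ.< b →
    + (p ℕ.^ a) / b < ε
  pᵃ/-small ε ε>0 a b refl = 1/-small ε ε>0 b

  small : ∀ ε → 0ℚ < ε → ∀ {k q} → ↧ₙ ε ℕ.≤ k → Divisible k q → ∣ q ∣[ v ] < ε
  small ε ε>0 {k} {q} ε≤k dv@(divisible w z p∤w _) = bound ℤ.∣ i ∣ pᵏ∣n
    where
    i = ↥ q
    d = ↧ₙ q

    nat-eq = Divisible⇒ℕ dv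

    pᵏ∣n : p ℕ.^ k ∣ ℤ.∣ i ∣
    pᵏ∣n = coprime-divisor (Coprimality.sym (∤⇒coprime^ k p∤w))
      (subst (p ℕ.^ k ∣_) (trans (trans (sym (ℕ.*-assoc (p ℕ.^ k) _ _)) (sym nat-eq)) (ℕ.*-comm ℤ.∣ i ∣ w))
        (m∣m*n (ℤ.∣ z ∣ ℕ.* d)))

    p∤d : p ∤ d
    p∤d p∣d = [ (λ p∣i → ℕ.nonTrivial⇒≢1 (↥⊥↧ q (p∣i , p∣d))) , p∤w ]′
      (euclidsLemma ℤ.∣ i ∣ w pr (subst (p ∣_) (sym nat-eq) (∣n⇒∣m*n (p ℕ.^ k ℕ.* ℤ.∣ z ∣) p∣d)))

    bound : ∀ n → p ℕ.^ k ∣ n → absFraction v n d < ε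
    bound zero      _    = ε>0
    bound n@(suc _) pᵏ∣n = pᵃ/-small ε ε>0 _ _ {{pᵏ≢0 (ord p n)}} (∤⇒ord≡0 d p∤d)
      (ℕ.≤-<-trans (ℕ.≤-trans ε≤k (∣⇒≤ord n pᵏ∣n)) (k<pᵏ (ord p n)))

  Divisible-+ : ∀ {k q r} → Divisible k q → Divisible k r → Divisible k (q + r)
  Divisible-+ {k} {q} {r} (divisible w z p∤w eq) (divisible w′ z′ p∤w′ eq′) =
    divisible (w ℕ.* w′) (z ℤ.* + w′ ℤ.+ z′ ℤ.* + w) (∤-* p∤w p∤w′) (begin
      (q + r) * fromℤ (+ (w ℕ.* w′))
        ≡⟨ cong (λ t → (q + r) * t) (trans (cong fromℤ (ℤ.pos-* w w′)) (fromℤ-* (+ w) (+ w′))) ⟩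
      (q + r) * (W * W′)
        ≡⟨ cross q r W W′ ⟩
      q * W * W′ + r * W′ * W
        ≡⟨ cong₂ (λ s t → s * W′ + t * W) eq eq′ ⟩
      fromℤ (P ℤ.* z) * W′ + fromℤ (P ℤ.* z′) * W
        ≡⟨ cong₂ _+_ (fromℤ-* (P ℤ.* z) (+ w′)) (fromℤ-* (P ℤ.* z′) (+ w)) ⟨
      fromℤ (P ℤ.* z ℤ.* + w′) + fromℤ (P ℤ.* z′ ℤ.* + w)
        ≡⟨ fromℤ-+ (P ℤ.* z ℤ.* + w′) (P ℤ.* z′ ℤ.* + w) ⟨
      fromℤ (P ℤ.* z ℤ.* + w′ ℤ.+ P ℤ.* z′ ℤ.* + w)
        ≡⟨ cong fromℤ (distrib P z z′ (+ w) (+ w′)) ⟩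
      fromℤ (P ℤ.* (z ℤ.* + w′ ℤ.+ z′ ℤ.* + w)) ∎)
    where
    open ≡-Reasoning
    W  = fromℤ (+ w)
    W′ = fromℤ (+ w′)
    P  = + (p ℕ.^ k)
    distrib : ∀ P z z′ w w′ → P ℤ.* z ℤ.* w′ ℤ.+ P ℤ.* z′ ℤ.* w ≡ P ℤ.* (z ℤ.* w′ ℤ.+ z′ ℤ.* w)
    distrib = ℤ-Ring.solve-∀

  Divisible-* : ∀ {k l q r} → Divisible k q → Divisible l r → Divisible (k ℕ.+ l) (q * r)
  Divisible-* {k} {l} {q} {r} (divisible w z p∤w eq) (divisible w′ z′ p∤w′ eq′) =
    divisible (w ℕ.* w′) (z ℤ.* z′) (∤-* p∤w p∤w′) (begin
      q * r * fromℤ (+ (w ℕ.* w′))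
        ≡⟨ cong (λ t → q * r * t) (trans (cong fromℤ (ℤ.pos-* w w′)) (fromℤ-* (+ w) (+ w′))) ⟩
      q * r * (W * W′)
        ≡⟨ exchange q r W W′ ⟩
      q * W * (r * W′)
        ≡⟨ cong₂ _*_ eq eq′ ⟩
      fromℤ (P ℤ.* z) * fromℤ (P′ ℤ.* z′)
        ≡⟨ fromℤ-* (P ℤ.* z) (P′ ℤ.* z′) ⟨
      fromℤ (P ℤ.* z ℤ.* (P′ ℤ.* z′))
        ≡⟨ cong fromℤ (interchange P z P′ z′) ⟩
      fromℤ (P ℤ.* P′ ℤ.* (z ℤ.* z′))
        ≡⟨ cong (λ t → fromℤ (t ℤ.* (z ℤ.* z′)))
             (trans (cong +_ (ℕ.^-distribˡ-+-* p k l)) (ℤ.pos-* (p ℕ.^ k) (p ℕ.^ l))) ⟨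
      fromℤ (+ (p ℕ.^ (k ℕ.+ l)) ℤ.* (z ℤ.* z′)) ∎)
    where
    open ≡-Reasoning
    W  = fromℤ (+ w)
    W′ = fromℤ (+ w′)
    P  = + (p ℕ.^ k)
    P′ = + (p ℕ.^ l)
    interchange : ∀ a b c d → a ℤ.* b ℤ.* (c ℤ.* d) ≡ a ℤ.* c ℤ.* (b ℤ.* d)
    interchange = ℤ-Ring.solve-∀

  Divisible-fromℤ : ∀ k z → Divisible k (fromℤ (+ (p ℕ.^ k) ℤ.* z))
  Divisible-fromℤ k z = divisible 1 z p∤1 (ℚ.*-identityʳ _)

  Divisible-0 : ∀ k → Divisible k 0ℚ
  Divisible-0 k = subst (Divisible k) (cong fromℤ (ℤ.*-zeroʳ (+ (p ℕ.^ k)))) (Divisible-fromℤ k 0ℤ)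

  Divisible-neg : ∀ {k q} → Divisible k q → Divisible k (- q)
  Divisible-neg {k} {q} (divisible w z p∤w eq) = divisible w (ℤ.- z) p∤w
    (trans (sym (ℚ.neg-distribˡ-* q (fromℤ (+ w)))) (trans (cong -_ eq)
      (trans (sym (fromℤ-neg (+ (p ℕ.^ k) ℤ.* z))) (cong fromℤ (ℤ.neg-distribʳ-* (+ (p ℕ.^ k)) z)))))

  Divisible-weaken : ∀ {j k q} → j ℕ.≤ k → Divisible k q → Divisible j q
  Divisible-weaken {j} {k} j≤k (divisible w z p∤w eq) = weaken (p^≤⇒∣ j≤k)
    where
    weaken : p ℕ.^ j ∣ p ℕ.^ k → Divisible j _
    weaken (divides t e) = divisible w (+ t ℤ.* z) p∤w (trans eq (cong fromℤ
      (trans (cong (ℤ._* z) (trans (cong +_ (trans e (ℕ.*-comm t _))) (ℤ.pos-* (p ℕ.^ j) t)))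
        (ℤ.*-assoc (+ (p ℕ.^ j)) (+ t) z))))

  ∣↥⇒Divisible : ∀ x → p ∣ ℤ.∣ ↥ x ∣ → Divisible 1 x
  ∣↥⇒Divisible x p∣i@(divides t e) = divisible (↧ₙ x) z
    (λ p∣d → ℕ.nonTrivial⇒≢1 (↥⊥↧ x (p∣i , p∣d)))
    (trans (↥≡*↧ x) (cong fromℤ (begin
      i                         ≡⟨ ℤ.◃-inverse i ⟨
      ℤ.sign i ℤ.◃ ℤ.∣ i ∣      ≡⟨ cong (ℤ.sign i ℤ.◃_) (trans e (ℕ.*-comm t p)) ⟩
      ℤ.sign i ℤ.◃ (p ℕ.* t)    ≡⟨ ℤ.◃-distrib-* Sign.+ (ℤ.sign i) p t ⟩
      (Sign.+ ℤ.◃ p) ℤ.* z      ≡⟨ cong (ℤ._* z) (ℤ.+◃n≡+n p) ⟩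
      + p ℤ.* z                 ≡⟨ cong (λ u → + u ℤ.* z) (ℕ.*-identityʳ p) ⟨
      + (p ℕ.^ 1) ℤ.* z         ∎)))
    where
    open ≡-Reasoning
    i = ↥ x
    z = ℤ.sign i ℤ.◃ t

  ∣<1⇒Divisible : ∀ x → ∣ x ∣[ v ] < 1ℚ → Divisible 1 x
  ∣<1⇒Divisible x lt = ∣↥⇒Divisible x (absFraction<1⇒∣ ℤ.∣ ↥ x ∣ (↧ₙ x) lt)

  Divisible-^ : ∀ {x} → Divisible 1 x → ∀ n → Divisible n (x ^ n)
  Divisible-^ dx zero    = Divisible-fromℤ 0 1ℤ
  Divisible-^ dx (suc n) = Divisible-* dx (Divisible-^ dx n)

  -- If b = m / d with p ∤ d and P is the p-part of n!, then m ≡ d B (mod P) for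
  -- some natural number B, so ∏_{i<n} (m - i d) ≡ dⁿ B(B-1)⋯(B-n+1) ≡ 0 (mod P).
  Divisible-binom : ∀ b n → p ∤ ↧ₙ b → Divisible 0 (binom b n)
  Divisible-binom b n p∤d =
    let u , n!≡Pu , p∤u = ord-spec (n !) {{n ℕ.!≢0}}
        z , eq = ∣progression (↥ b) d n P u {{pᵏ≢0 k}} (∤⇒coprime^ k p∤d) n!≡Pu
    in divisible (d ℕ.^ n ℕ.* u) z (∤-* (∤-^ n p∤d) p∤u)
      (trans (cancelled u z n!≡Pu eq) (cong fromℤ (sym (ℤ.*-identityˡ z))))
    where
    open ≡-Reasoning
    d = ↧ₙ b
    k = ord p (n !)
    P = p ℕ.^ k
    PQ = fromℤ (+ P)
    DQ = fromℤ (+ (d ℕ.^ n))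
    β  = binom b n

    rearrange : ∀ b D U P → b * (D * U) * P ≡ b * (P * U) * D
    rearrange = solve 4 (λ b D U P → b :* (D :* U) :* P := b :* (P :* U) :* D) refl

    cancelled : ∀ u z → n ! ≡ P ℕ.* u → progression (↥ b) (+ d) n ≡ + P ℤ.* z →
      β * fromℤ (+ (d ℕ.^ n ℕ.* u)) ≡ fromℤ z
    cancelled u z n!≡Pu eq = *-cancelʳ-≡ PQ {{pᵏ≢0 k}} (begin
      β * fromℤ (+ (d ℕ.^ n ℕ.* u)) * PQ
        ≡⟨ cong (λ t → β * t * PQ)
             (trans (cong fromℤ (ℤ.pos-* (d ℕ.^ n) u)) (fromℤ-* (+ (d ℕ.^ n)) (+ u))) ⟩
      β * (DQ * fromℤ (+ u)) * PQ
        ≡⟨ rearrange β DQ (fromℤ (+ u)) PQ ⟩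
      β * (PQ * fromℤ (+ u)) * DQ
        ≡⟨ cong (λ t → β * t * DQ)
             (trans (cong fromℤ (trans (cong +_ n!≡Pu) (ℤ.pos-* P u))) (fromℤ-* (+ P) (+ u))) ⟨
      β * fromℤ (+ (n !)) * DQ
        ≡⟨ cong (λ t → t * DQ) (binom*! b n) ⟩
      falling b n * DQ
        ≡⟨ falling-progression b (↥ b) d n (↥≡*↧ b) ⟩
      fromℤ (progression (↥ b) (+ d) n)
        ≡⟨ cong fromℤ (trans eq (ℤ.*-comm (+ P) z)) ⟩
      fromℤ (z ℤ.* + P)
        ≡⟨ fromℤ-* z (+ P) ⟩
      fromℤ z * PQ ∎)

  Divisible-term : ∀ b x → ∣ x ∣[ v ] < 1ℚ → ∣ b ∣[ v ] ≤ 1ℚ → ∀ n → Divisible n (term b x n)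
  Divisible-term b x ∣x∣<1 ∣b∣≤1 n =
    Divisible-* (Divisible-binom b n (∣≤1⇒∤↧ b ∣b∣≤1)) (Divisible-^ (∣<1⇒Divisible x ∣x∣<1) n)

  Divisible-tail : ∀ a → (∀ n → Divisible n (a n)) → ∀ k j →
    Divisible k (partialSum a (j ℕ.+ k) - partialSum a k)
  Divisible-tail a da k zero    = subst (Divisible k) (sym (ℚ.+-inverseʳ (partialSum a k))) (Divisible-0 k)
  Divisible-tail a da k (suc j) = subst (Divisible k)
    (swapLast (partialSum a (j ℕ.+ k)) (partialSum a k) (a (j ℕ.+ k)))
    (Divisible-+ (Divisible-tail a da k j) (Divisible-weaken (ℕ.m≤n+m k j) (da (j ℕ.+ k))))
    where
    swapLast : ∀ s t u → s - t + u ≡ s + u - t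
    swapLast = solve 3 (λ s t u → s :- t :+ u := s :+ u :- t) refl

  abstract
    partialSum-cauchy : ∀ a → (∀ n → Divisible n (a n)) → ∀ ε → 0ℚ < ε →
      ∃[ N ] ∀ m n → N ℕ.≤ m → N ℕ.≤ n → ∣ partialSum a m - partialSum a n ∣[ v ] < ε
    partialSum-cauchy a da ε ε>0 = ↧ₙ ε , close
      where
      ordered : ∀ {k m} → k ℕ.≤ m → Divisible k (partialSum a m - partialSum a k)
      ordered {k} {m} k≤m = subst (λ l → Divisible k (partialSum a l - partialSum a k)) (ℕ.m∸n+n≡m k≤m)
        (Divisible-tail a da k (m ℕ.∸ k))

      flip- : ∀ s t → - (s - t) ≡ t - s
      flip- = solve 2 (λ s t → :- (s :- t) := t :- s) refl

      close : ∀ m n → ↧ₙ ε ℕ.≤ m → ↧ₙ ε ℕ.≤ n → ∣ partialSum a m - partialSum a n ∣[ v ] < ε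
      close m n N≤m N≤n =
        [ (λ m≤n → small ε ε>0 N≤m
            (subst (Divisible m) (flip- (partialSum a n) (partialSum a m)) (Divisible-neg (ordered m≤n))))
        , (λ n≤m → small ε ε>0 N≤n (ordered n≤m))
        ]′ (ℕ.≤-total m n)

-- The element of ℚ_v represented by the Cauchy sequence of partial sums is,
-- by F-sum, the sum of the series in ℚ_v.
F : (v : V) (b x : ℚ) → ∣ x ∣[ v ] < 1ℚ → ∣ b ∣[ v ] ≤ 1ℚ → ℚ⟨ v ⟩
F v b x ∣x∣<1 ∣b∣≤1 = completion (partialSum (term b x))
  (partialSum-cauchy v (term b x) (Divisible-term v b x ∣x∣<1 ∣b∣≤1))

F-sum : ∀ v b x ∣x∣<1 ∣b∣≤1 → (λ n → ι (partialSum (term b x) n)) ⟶ F v b x ∣x∣<1 ∣b∣≤1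
F-sum v b x ∣x∣<1 ∣b∣≤1 ε ε>0 =
  let N , close = cauchy (F v b x ∣x∣<1 ∣b∣≤1) ε ε>0
  in N , λ n N≤n → N , λ m N≤m → close n m N≤n N≤m

-- Vandermonde's identity makes the truncated series multiplicative in the
-- exponent modulo powers of v. Writing s b + k = m with natural numbers
-- s, k, m, where s is the denominator of b, the partial sums therefore satisfy
-- S_n(b) ^ s (1 + x) ^ k ≡ (1 + x) ^ m (mod v ^ n). At v′ the limit is the
-- equation c ^ s (1 + x) ^ k = (1 + x) ^ m between rational numbers. At v one
-- of ± c, call it d, satisfies the same equation and is 1 modulo v; since
-- (S ^ s - d ^ s) / (S - d) ≡ s (mod v) is a unit, S_n(b) ≡ d (mod v ^ n).
module Submission where

open import Defs
open import Data.Integer.Base as ℤ using (ℤ; NonZero; +_; -[1+_])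
import Data.Integer.Properties as ℤ
open import Data.Nat.Base as ℕ using (ℕ; zero; suc; _!; z≤n; s≤s)
import Data.Nat.Properties as ℕ
open import Data.Nat.Divisibility using (_∣_; _∤_; divides; m∣m*n; ∣-trans)
open import Data.Nat.Primality using (prime⇒nonZero; prime⇒nonTrivial; euclidsLemma)
open import Data.Product.Base using (∃-syntax; _×_; _,_; proj₁; proj₂)
open import Data.Rational.Base as ℚ
  using (ℚ; 0ℚ; 1ℚ; _+_; _*_; _-_; -_; _÷_; _/_; _<_; _≤_; ↥_; ↧ₙ_)
import Data.Rational.Properties as ℚ
open import Data.Rational.Literals using (fromℤ)
open import Data.Rational.Solver using (module +-*-Solver)
open import Data.Rational.Unnormalised.Base using (mkℚᵘ)
import Data.Rational.Unnormalised.Properties as ℚᵘ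
import Data.Sign.Base as Sign
open import Data.Sum.Base using (_⊎_; inj₁; inj₂; [_,_]′)
open import Algebra.Definitions.RawSemiring ℚ.+-*-rawSemiring using (_^_)
open import Relation.Binary.PropositionalEquality
open import Relation.Nullary using (¬_; yes; no; contradiction)

open +-*-Solver using (solve; _:=_; _:+_; _:*_; :-_; _:-_; con)
open ≡-Reasoning

-- Cauchy products of coefficient sequences.

fromℕ : ℕ → ℚ
fromℕ n = fromℤ (+ n)

fromℕ-suc : ∀ n → fromℕ (suc n) ≡ 1ℚ + fromℕ n
fromℕ-suc n = fromℤ-+ (+ 1) (+ n)

-- The Cauchy product, with `f` shifted at each step instead of `g` indexed by a difference `n - k`.
-- Inductions therefore generalise over `f`.
conv : (ℕ → ℚ) → (ℕ → ℚ) → ℕ → ℚ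
conv f g zero    = f 0 * g 0
conv f g (suc n) = f 0 * g (suc n) + conv (λ k → f (suc k)) g n

conv-cong : ∀ {f f′ g g′} → (∀ n → f n ≡ f′ n) → (∀ n → g n ≡ g′ n) →
  ∀ n → conv f g n ≡ conv f′ g′ n
conv-cong f≗ g≗ zero    = cong₂ _*_ (f≗ 0) (g≗ 0)
conv-cong f≗ g≗ (suc n) = cong₂ _+_ (cong₂ _*_ (f≗ 0) (g≗ (suc n)))
  (conv-cong (λ k → f≗ (suc k)) g≗ n)

-- The definition peels off `f 0`. Peeling off `g 0` instead is what exposes the shifted second
-- factor in `recurrence-conv`.
conv-sucʳ : ∀ f g n → conv f g (suc n) ≡ conv f (λ k → g (suc k)) n + f (suc n) * g 0
conv-sucʳ f g zero    = refl
conv-sucʳ f g (suc n) = trans (cong (λ t → f 0 * g (suc (suc n)) + t) (conv-sucʳ (λ k → f (suc k)) g n))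
  (sym (ℚ.+-assoc (f 0 * g (suc (suc n))) (conv (λ k → f (suc k)) (λ k → g (suc k)) n)
    (f (suc (suc n)) * g 0)))

conv-linearˡ : ∀ α β f f′ g n →
  conv (λ k → α * f k + β * f′ k) g n ≡ α * conv f g n + β * conv f′ g n
conv-linearˡ α β f f′ g zero    = distrib α β (f 0) (f′ 0) (g 0)
  where
  distrib : ∀ α β y y′ z → (α * y + β * y′) * z ≡ α * (y * z) + β * (y′ * z)
  distrib = solve 5 (λ α β y y′ z →
    (α :* y :+ β :* y′) :* z := α :* (y :* z) :+ β :* (y′ :* z)) refl
conv-linearˡ α β f f′ g (suc n) =
  trans (cong (λ t → (α * f 0 + β * f′ 0) * g (suc n) + t) (conv-linearˡ α β (λ k → f (suc k)) (λ k → f′ (suc k)) g n))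
        (distrib α β (f 0) (f′ 0) (g (suc n)) (conv (λ k → f (suc k)) g n) (conv (λ k → f′ (suc k)) g n))
  where
  distrib : ∀ α β y y′ z c c′ → (α * y + β * y′) * z + (α * c + β * c′) ≡
    α * (y * z + c) + β * (y′ * z + c′)
  distrib = solve 7 (λ α β y y′ z c c′ → (α :* y :+ β :* y′) :* z :+ (α :* c :+ β :* c′) :=
    α :* (y :* z :+ c) :+ β :* (y′ :* z :+ c′)) refl

conv-linearʳ : ∀ α β f g g′ n →
  conv f (λ k → α * g k + β * g′ k) n ≡ α * conv f g n + β * conv f g′ n
conv-linearʳ α β f g g′ zero    = distrib α β (f 0) (g 0) (g′ 0)
  where
  distrib : ∀ α β y z z′ → y * (α * z + β * z′) ≡ α * (y * z) + β * (y * z′)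
  distrib = solve 5 (λ α β y z z′ →
    y :* (α :* z :+ β :* z′) := α :* (y :* z) :+ β :* (y :* z′)) refl
conv-linearʳ α β f g g′ (suc n) =
  trans (cong (λ t → f 0 * (α * g (suc n) + β * g′ (suc n)) + t) (conv-linearʳ α β (λ k → f (suc k)) g g′ n))
        (distrib α β (f 0) (g (suc n)) (g′ (suc n)) (conv (λ k → f (suc k)) g n) (conv (λ k → f (suc k)) g′ n))
  where
  distrib : ∀ α β y z z′ c c′ → y * (α * z + β * z′) + (α * c + β * c′) ≡
    α * (y * z + c) + β * (y * z′ + c′)
  distrib = solve 7 (λ α β y z z′ c c′ → y :* (α :* z :+ β :* z′) :+ (α :* c :+ β :* c′) :=
    α :* (y :* z :+ c) :+ β :* (y :* z′ :+ c′)) refl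

-- The operator t · d/dt on power series in t.
euler : (ℕ → ℚ) → ℕ → ℚ
euler f n = fromℕ n * f n

-- The Leibniz rule: t d/dt is a derivation for the product of power series.
euler-conv : ∀ f g n → euler (conv f g) n ≡ conv (euler f) g n + conv f (euler g) n
euler-conv f g zero    = vanish (f 0) (g 0)
  where
  vanish : ∀ y z → 0ℚ * (y * z) ≡ 0ℚ * y * z + y * (0ℚ * z)
  vanish = solve 2 (λ y z → con 0ℚ :* (y :* z) := con 0ℚ :* y :* z :+ y :* (con 0ℚ :* z)) refl
euler-conv f g (suc n) = begin
  N′ * (f 0 * g (suc n) + C)
    ≡⟨ cong (_* (f 0 * g (suc n) + C)) (fromℕ-suc n) ⟩
  (1ℚ + N) * (f 0 * g (suc n) + C)
    ≡⟨ expand N (f 0) (g (suc n)) C ⟩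
  f 0 * ((1ℚ + N) * g (suc n)) + (1ℚ * C + N * C)
    ≡⟨ cong₂ (λ s t → f 0 * (s * g (suc n)) + (1ℚ * C + t)) (sym (fromℕ-suc n)) (euler-conv f′ g n) ⟩
  f 0 * (N′ * g (suc n)) + (1ℚ * C + (A + B))
    ≡⟨ regroup (f 0) (g (suc n)) (f 0 * (N′ * g (suc n))) C A B ⟩
  0ℚ * f 0 * g (suc n) + (1ℚ * C + 1ℚ * A) + (f 0 * (N′ * g (suc n)) + B)
    ≡⟨ cong (λ t → 0ℚ * f 0 * g (suc n) + t + (f 0 * (N′ * g (suc n)) + B)) shifted ⟨
  conv (euler f) g (suc n) + conv f (euler g) (suc n) ∎
  where
  f′ = λ k → f (suc k)
  N  = fromℕ n
  N′ = fromℕ (suc n)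
  C  = conv f′ g n
  A  = conv (euler f′) g n
  B  = conv f′ (euler g) n
  expand : ∀ N y z C → (1ℚ + N) * (y * z + C) ≡ y * ((1ℚ + N) * z) + (1ℚ * C + N * C)
  expand = solve 4 (λ N y z C → (con 1ℚ :+ N) :* (y :* z :+ C) :=
    y :* ((con 1ℚ :+ N) :* z) :+ (con 1ℚ :* C :+ N :* C)) refl
  regroup : ∀ y z s C A B →
    s + (1ℚ * C + (A + B)) ≡ 0ℚ * y * z + (1ℚ * C + 1ℚ * A) + (s + B)
  regroup = solve 6 (λ y z s C A B → s :+ (con 1ℚ :* C :+ (A :+ B)) :=
    con 0ℚ :* y :* z :+ (con 1ℚ :* C :+ con 1ℚ :* A) :+ (s :+ B)) refl
  -- Dropping the first coefficient turns the weight k into k + 1, hence one extra copy of `f′`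
  -- beside `euler f′`.
  shifted : conv (λ k → euler f (suc k)) g n ≡ 1ℚ * C + 1ℚ * A
  shifted = trans
    (conv-cong {g = g} (λ k → trans (cong (_* f′ k) (fromℕ-suc k)) (split (fromℕ k) (f′ k))) (λ _ → refl) n)
    (conv-linearˡ 1ℚ 1ℚ f′ (euler f′) g n)
    where
    split : ∀ N y → (1ℚ + N) * y ≡ 1ℚ * y + 1ℚ * (N * y)
    split = solve 2 (λ N y → (con 1ℚ :+ N) :* y := con 1ℚ :* y :+ con 1ℚ :* (N :* y)) refl

-- The binomial recurrence and Vandermonde's identity.

-- The coefficientwise form of (1 + x t) y′ = b x y, which characterises (1 + x t)ᵇ.
record BinomialRecurrence (b x : ℚ) (f : ℕ → ℚ) : Set where
  field
    step : ∀ n → fromℕ (suc n) * f (suc n) ≡ (b - fromℕ n) * x * f n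

open BinomialRecurrence

-- In characteristic 0 the factor n + 1 is invertible, so each coefficient is determined by the
-- preceding one.
recurrence-unique : ∀ {b x f g} → BinomialRecurrence b x f → BinomialRecurrence b x g →
  f 0 ≡ g 0 → ∀ n → f n ≡ g n
recurrence-unique rf rg eq zero    = eq
recurrence-unique {b} {x} {f} {g} rf rg eq (suc n) = *-cancelʳ-≡ (fromℕ (suc n)) (begin
  f (suc n) * fromℕ (suc n)   ≡⟨ ℚ.*-comm (f (suc n)) (fromℕ (suc n)) ⟩
  fromℕ (suc n) * f (suc n)   ≡⟨ rf .step n ⟩
  (b - fromℕ n) * x * f n     ≡⟨ cong ((b - fromℕ n) * x *_) (recurrence-unique rf rg eq n) ⟩
  (b - fromℕ n) * x * g n     ≡⟨ rg .step n ⟨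
  fromℕ (suc n) * g (suc n)   ≡⟨ ℚ.*-comm (fromℕ (suc n)) (g (suc n)) ⟩
  g (suc n) * fromℕ (suc n)   ∎)

recurrence-term : ∀ b x → BinomialRecurrence b x (term b x)
-- Multiplying by n! clears the denominators of both binomial coefficients.
recurrence-term b x .step n = *-cancelʳ-≡ n!ℚ {{n ℕ.!≢0}} (begin
  N′ * (β′ * (x * xⁿ)) * n!ℚ
    ≡⟨ gather N′ β′ x xⁿ n!ℚ ⟩
  β′ * (N′ * n!ℚ) * (x * xⁿ)
    ≡⟨ cong (λ t → β′ * t * (x * xⁿ))
         (trans (cong fromℤ (ℤ.pos-* (suc n) (n !))) (fromℤ-* (+ suc n) (+ (n !)))) ⟨
  β′ * fromℕ (suc n !) * (x * xⁿ)
    ≡⟨ cong (_* (x * xⁿ)) (binom*! b (suc n)) ⟩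
  falling b n * (b - fromℕ n) * (x * xⁿ)
    ≡⟨ cong (λ t → t * (b - fromℕ n) * (x * xⁿ)) (binom*! b n) ⟨
  β * n!ℚ * (b - fromℕ n) * (x * xⁿ)
    ≡⟨ scatter β n!ℚ (b - fromℕ n) x xⁿ ⟩
  (b - fromℕ n) * x * (β * xⁿ) * n!ℚ ∎)
  where
  N′  = fromℕ (suc n)
  n!ℚ = fromℕ (n !)
  β   = binom b n
  β′  = binom b (suc n)
  xⁿ  = x ^ n
  gather : ∀ N β x y f → N * (β * (x * y)) * f ≡ β * (N * f) * (x * y)
  gather = solve 5 (λ N β x y f → N :* (β :* (x :* y)) :* f := β :* (N :* f) :* (x :* y)) refl
  scatter : ∀ β f d x y → β * f * d * (x * y) ≡ d * x * (β * y) * f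
  scatter = solve 5 (λ β f d x y → β :* f :* d :* (x :* y) := d :* x :* (β :* y) :* f) refl

-- If (1 + x t) y′ = a x y and (1 + x t) z′ = b x z, then (1 + x t) (y z)′ = (a + b) x y z. The
-- Leibniz rule is used twice: to split the left side, and to reassemble the terms with factor - x.
recurrence-conv : ∀ {a b x f g} → BinomialRecurrence a x f → BinomialRecurrence b x g →
  BinomialRecurrence (a + b) x (conv f g)
recurrence-conv {a} {b} {x} {f} {g} rf rg .step n = begin
  fromℕ (suc n) * conv f g (suc n)
    ≡⟨ euler-conv f g (suc n) ⟩
  conv (euler f) g (suc n) + conv f (euler g) (suc n)
    ≡⟨ cong (λ t → conv (euler f) g (suc n) + t) (conv-sucʳ f (euler g) n) ⟩
  0ℚ * f 0 * g (suc n) + conv (λ k → euler f (suc k)) g n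
    + (conv f (λ k → euler g (suc k)) n + f (suc n) * (0ℚ * g 0))
    ≡⟨ cong₂ (λ s t → 0ℚ * f 0 * g (suc n) + s + (t + f (suc n) * (0ℚ * g 0))) left right ⟩
  0ℚ * f 0 * g (suc n) + (a * x * C + - x * A) + (b * x * C + - x * B + f (suc n) * (0ℚ * g 0))
    ≡⟨ collect (f 0) (g (suc n)) a b x C A B (f (suc n)) (g 0) ⟩
  (a + b) * x * C - x * (A + B)
    ≡⟨ cong (λ t → (a + b) * x * C - x * t) (euler-conv f g n) ⟨
  (a + b) * x * C - x * (fromℕ n * C)
    ≡⟨ factor (a + b) x C (fromℕ n) ⟩
  (a + b - fromℕ n) * x * C ∎
  where
  C = conv f g n
  A = conv (euler f) g n
  B = conv f (euler g) n
  split : ∀ a N x y → (a - N) * x * y ≡ a * x * y + - x * (N * y)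
  split = solve 4 (λ a N x y → (a :- N) :* x :* y := a :* x :* y :+ :- x :* (N :* y)) refl
  left : conv (λ k → euler f (suc k)) g n ≡ a * x * C + - x * A
  left = trans
    (conv-cong {g = g} (λ k → trans (rf .step k) (split a (fromℕ k) x (f k))) (λ _ → refl) n)
    (conv-linearˡ (a * x) (- x) f (euler f) g n)
  right : conv f (λ k → euler g (suc k)) n ≡ b * x * C + - x * B
  right = trans
    (conv-cong {f = f} (λ _ → refl) (λ k → trans (rg .step k) (split b (fromℕ k) x (g k))) n)
    (conv-linearʳ (b * x) (- x) f g (euler g) n)
  collect : ∀ y z a b x C A B y′ z′ →
    0ℚ * y * z + (a * x * C + - x * A) + (b * x * C + - x * B + y′ * (0ℚ * z′)) ≡
    (a + b) * x * C - x * (A + B)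
  collect = solve 10 (λ y z a b x C A B y′ z′ →
    con 0ℚ :* y :* z :+ (a :* x :* C :+ :- x :* A) :+ (b :* x :* C :+ :- x :* B :+ y′ :* (con 0ℚ :* z′)) :=
    (a :+ b) :* x :* C :- x :* (A :+ B)) refl
  factor : ∀ a x C N → a * x * C - x * (N * C) ≡ (a - N) * x * C
  factor = solve 4 (λ a x C N → a :* x :* C :- x :* (N :* C) := (a :- N) :* x :* C) refl

-- Both sides satisfy the recurrence for exponent a + b, and both constant coefficients compute to
-- 1.
term-vandermonde : ∀ a b x n → conv (term a x) (term b x) n ≡ term (a + b) x n
term-vandermonde a b x = recurrence-unique
  (recurrence-conv (recurrence-term a x) (recurrence-term b x)) (recurrence-term (a + b) x) refl

term-0 : ∀ x n → term 0ℚ x (suc n) ≡ 0ℚ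
term-0 x n = recurrence-unique (recurrence-term 0ℚ x) rδ refl (suc n)
  where
  δ : ℕ → ℚ
  δ zero    = 1ℚ
  δ (suc _) = 0ℚ
  rδ : BinomialRecurrence 0ℚ x δ
  rδ .step zero    = solve 1 (λ x → con 1ℚ :* con 0ℚ := con 0ℚ :* x :* con 1ℚ) refl x
  rδ .step (suc n) = trans (ℚ.*-zeroʳ (fromℕ (suc (suc n)))) (sym (ℚ.*-zeroʳ ((0ℚ - fromℕ (suc n)) * x)))

module _ (x : ℚ) where
  linear : ℕ → ℚ
  linear zero          = 1ℚ
  linear (suc zero)    = x
  linear (suc (suc _)) = 0ℚ

  recurrence-linear : BinomialRecurrence 1ℚ x linear
  recurrence-linear .step zero          = solve 1 (λ x → con 1ℚ :* x := con 1ℚ :* x :* con 1ℚ) refl x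
  -- Here b - n = 1 - 1 = 0, which is why the series stops after the linear term.
  recurrence-linear .step (suc zero)    = solve 1 (λ x → con (fromℕ 2) :* con 0ℚ := con 0ℚ :* x :* x) refl x
  recurrence-linear .step (suc (suc n)) = trans (ℚ.*-zeroʳ (fromℕ (suc (suc (suc n)))))
    (sym (ℚ.*-zeroʳ ((1ℚ - fromℕ (suc (suc n))) * x)))

  term-1 : ∀ n → term 1ℚ x n ≡ linear n
  term-1 = recurrence-unique (recurrence-term 1ℚ x) recurrence-linear refl

-- Partial sums.

partialSum-shift : ∀ f n → partialSum f (suc n) ≡ f 0 + partialSum (λ k → f (suc k)) n
partialSum-shift f zero    = ℚ.+-comm 0ℚ (f 0)
partialSum-shift f (suc n) = trans (cong (_+ f (suc n)) (partialSum-shift f n)) (ℚ.+-assoc (f 0) (partialSum (λ k → f (suc k)) n) (f (suc n)))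

partialSum-cong : ∀ {f g} → (∀ n → f n ≡ g n) → ∀ n → partialSum f n ≡ partialSum g n
partialSum-cong f≗g zero    = refl
partialSum-cong f≗g (suc n) = cong₂ _+_ (partialSum-cong f≗g n) (f≗g n)

partialSum-0 : ∀ f → (∀ n → f n ≡ 0ℚ) → ∀ n → partialSum f n ≡ 0ℚ
partialSum-0 f f≗0 zero    = refl
partialSum-0 f f≗0 (suc n) = cong₂ _+_ (partialSum-0 f f≗0 n) (f≗0 n)

sum-term-0 : ∀ x n → partialSum (term 0ℚ x) (suc n) ≡ 1ℚ
sum-term-0 x n = trans (partialSum-shift (term 0ℚ x) n)
  (cong (λ t → 1ℚ + t) (partialSum-0 (λ k → term 0ℚ x (suc k)) (term-0 x) n))

-- Two terms are needed to reach the linear one. This is why later congruences concern truncations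
-- of length at least two.
sum-term-1 : ∀ x n → partialSum (term 1ℚ x) (suc (suc n)) ≡ 1ℚ + x
sum-term-1 x n = begin
  partialSum (term 1ℚ x) (suc (suc n))
    ≡⟨ partialSum-cong (term-1 x) (suc (suc n)) ⟩
  partialSum (linear x) (suc (suc n))
    ≡⟨ partialSum-shift (linear x) (suc n) ⟩
  1ℚ + partialSum (λ k → linear x (suc k)) (suc n)
    ≡⟨ cong (λ t → 1ℚ + t) (partialSum-shift (λ k → linear x (suc k)) n) ⟩
  1ℚ + (x + partialSum (λ _ → 0ℚ) n)
    ≡⟨ cong (λ t → 1ℚ + (x + t)) (partialSum-0 (λ _ → 0ℚ) (λ _ → refl) n) ⟩
  1ℚ + (x + 0ℚ)
    ≡⟨ cong (λ t → 1ℚ + t) (ℚ.+-identityʳ x) ⟩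
  1ℚ + x ∎

-- Groups the products by the index in `f`: the first coefficient meets all of g 0, ..., g n, and
-- the others form a truncation one shorter. This is the form needed for the induction in
-- `partialSum-conv`.
partialSum-conv-suc : ∀ f g n → partialSum (conv f g) (suc n) ≡
  f 0 * partialSum g (suc n) + partialSum (conv (λ k → f (suc k)) g) n
partialSum-conv-suc f g zero    = base (f 0) (g 0)
  where
  base : ∀ y z → 0ℚ + y * z ≡ y * (0ℚ + z) + 0ℚ
  base = solve 2 (λ y z → con 0ℚ :+ y :* z := y :* (con 0ℚ :+ z) :+ con 0ℚ) refl
partialSum-conv-suc f g (suc n) = trans
  (cong (_+ (f 0 * g (suc n) + C)) (partialSum-conv-suc f g n))
  (regroup (f 0) (partialSum g (suc n)) (partialSum (conv (λ k → f (suc k)) g) n) (g (suc n)) C)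
  where
  C = conv (λ k → f (suc k)) g n
  regroup : ∀ y s t z c → y * s + t + (y * z + c) ≡ y * (s + z) + (t + c)
  regroup = solve 5 (λ y s t z c → y :* s :+ t :+ (y :* z :+ c) := y :* (s :+ z) :+ (t :+ c)) refl

-- Auxiliary facts on signs and fractions.

neg-involutive : ∀ q → - - q ≡ q
neg-involutive = solve 1 (λ q → :- :- q := q) refl

neg-^ : ∀ q n → (- q) ^ n ≡ q ^ n ⊎ (- q) ^ n ≡ - (q ^ n)
neg-^ q zero    = inj₁ refl
neg-^ q (suc n) with neg-^ q n
... | inj₁ eq = inj₂ (trans (cong (- q *_) eq) (sym (ℚ.neg-distribˡ-* q (q ^ n))))
... | inj₂ eq = inj₁ (trans (cong (- q *_) eq) (neg-*-neg q (q ^ n)))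
  where
  neg-*-neg : ∀ x y → - x * - y ≡ x * y
  neg-*-neg = solve 2 (λ x y → :- x :* :- y := x :* y) refl

<-/⇒< : ∀ a b c d .{{_ : ℕ.NonZero b}} .{{_ : ℕ.NonZero d}} →
  + a / b < + c / d → a ℕ.* d ℕ.< c ℕ.* b
<-/⇒< a b@(suc b-1) c d@(suc d-1) lt =
  ℤ.drop‿+<+ (subst₂ ℤ._<_ (sym (ℤ.pos-* a d)) (sym (ℤ.pos-* c b))
    (ℚᵘ.drop-*<* (ℚᵘ.<-respˡ-≃ (ℚ.toℚᵘ-fromℚᵘ (mkℚᵘ (+ a) b-1))
      (ℚᵘ.<-respʳ-≃ (ℚ.toℚᵘ-fromℚᵘ (mkℚᵘ (+ c) d-1)) (ℚ.toℚᵘ-mono-< lt)))))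

-- Absolute value, divisibility and units at v.

module _ (v : V) where

  private
    p  = proj₁ v
    pr = proj₂ v

    instance
      p≢0 : ℕ.NonZero p
      p≢0 = prime⇒nonZero pr

    pᵏ≢0 : ∀ k → ℕ.NonZero (p ℕ.^ k)
    pᵏ≢0 k = ℕ.m^n≢0 p k

  pᵃ/pᵇ : ℕ → ℕ → ℚ
  pᵃ/pᵇ a b = + (p ℕ.^ a) / (p ℕ.^ b)
    where instance _ = pᵏ≢0 b

  pᵃ/pᵇ>0 : ∀ a b → 0ℚ < pᵃ/pᵇ a b
  pᵃ/pᵇ>0 a b = ℚ.positive⁻¹ (pᵃ/pᵇ a b)
    {{ℚ.normalize-pos (p ℕ.^ a) (p ℕ.^ b) {{pᵏ≢0 b}} {{pᵏ≢0 a}}}}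

  ∣∣>0 : ∀ q → q ≢ 0ℚ → 0ℚ < ∣ q ∣[ v ]
  ∣∣>0 q q≢0 with ℤ.∣ ↥ q ∣ in eq
  ... | zero    = contradiction (ℚ.↥p≡0⇒p≡0 q (ℤ.∣i∣≡0⇒i≡0 eq)) q≢0
  ... | suc n-1 = pᵃ/pᵇ>0 (ord p (↧ₙ q)) (ord p (suc n-1))

  Divisible-all⇒≡0 : ∀ q → (∀ k → Divisible v k q) → q ≡ 0ℚ
  Divisible-all⇒≡0 q all with q ℚ.≟ 0ℚ
  ... | yes q≡0 = q≡0
  -- With ε = ∣ q ∣, divisibility to the exponent given by the denominator of ε would yield ∣ q ∣ <
  -- ∣ q ∣.
  ... | no  q≢0 = contradiction (small v ∣ q ∣[ v ] (∣∣>0 q q≢0) ℕ.≤-refl (all (↧ₙ ∣ q ∣[ v ])))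
                                (ℚ.<-irrefl refl)

  ∣↥⇒Divisible^ : ∀ {k} q → p ∤ ↧ₙ q → p ℕ.^ k ∣ ℤ.∣ ↥ q ∣ → Divisible v k q
  ∣↥⇒Divisible^ {k} q p∤d (divides t e) = divisible (↧ₙ q) z p∤d
    (trans (↥≡*↧ q) (cong fromℤ (begin
      i                             ≡⟨ ℤ.◃-inverse i ⟨
      ℤ.sign i ℤ.◃ ℤ.∣ i ∣          ≡⟨ cong (ℤ.sign i ℤ.◃_) (trans e (ℕ.*-comm t (p ℕ.^ k))) ⟩
      ℤ.sign i ℤ.◃ (p ℕ.^ k ℕ.* t)  ≡⟨ ℤ.◃-distrib-* Sign.+ (ℤ.sign i) (p ℕ.^ k) t ⟩
      (Sign.+ ℤ.◃ (p ℕ.^ k)) ℤ.* z  ≡⟨ cong (ℤ._* z) (ℤ.+◃n≡+n (p ℕ.^ k)) ⟩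
      + (p ℕ.^ k) ℤ.* z             ∎)))
    where
    i = ↥ q
    z = ℤ.sign i ℤ.◃ t

  -- Let o be the order of the numerator. The inequality forces p ^ k < p ^ o, so p ^ k divides the
  -- numerator. As o > 0, lowest terms keep p out of the denominator.
  <p⁻ᵏ⇒Divisible : ∀ {k} q → ∣ q ∣[ v ] < pᵃ/pᵇ 0 k → Divisible v k q
  <p⁻ᵏ⇒Divisible {k} q lt with ℤ.∣ ↥ q ∣ in eq
  ... | zero    = subst (Divisible v k) (sym (ℚ.↥p≡0⇒p≡0 q (ℤ.∣i∣≡0⇒i≡0 eq))) (Divisible-0 v k)
  ... | n@(suc _) = ∣↥⇒Divisible^ q (λ p∣d → ℕ.nonTrivial⇒≢1 {{prime⇒nonTrivial pr}} (↥⊥↧ q (p∣↥ , p∣d)))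
                                    (subst (p ℕ.^ k ∣_) (sym eq) (∣-trans (p^≤⇒∣ v (ℕ.<⇒≤ k<o)) p^o∣n))
    where
    o = ord p n
    a = p ℕ.^ ord p (↧ₙ q)

    p^k<p^o : p ℕ.^ k ℕ.< p ℕ.^ o
    p^k<p^o = ℕ.≤-<-trans (ℕ.m≤n*m (p ℕ.^ k) a {{pᵏ≢0 (ord p (↧ₙ q))}})
      (subst (a ℕ.* p ℕ.^ k ℕ.<_) (ℕ.*-identityˡ (p ℕ.^ o))
        (<-/⇒< a (p ℕ.^ o) 1 (p ℕ.^ k) {{pᵏ≢0 o}} {{pᵏ≢0 k}} lt))

    k<o : k ℕ.< o
    k<o = ℕ.≰⇒> λ o≤k → ℕ.<⇒≱ p^k<p^o (ℕ.^-monoʳ-≤ p o≤k)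

    p^o∣n : p ℕ.^ o ∣ n
    p^o∣n = let m , n≡ , _ = ord-spec v n in subst (p ℕ.^ o ∣_) (sym n≡) (m∣m*n m)

    p∣↥ : p ∣ ℤ.∣ ↥ q ∣
    p∣↥ = subst (p ∣_) (sym eq) (∣-trans
      (subst (_∣ p ℕ.^ o) (ℕ.*-identityʳ p) (p^≤⇒∣ v (ℕ.≤-trans (s≤s z≤n) k<o))) p^o∣n)

  -- An integer prime to p can be absorbed into the cofactor of the witness.
  Divisible-cancelℤ : ∀ {k q} i → p ∤ ℤ.∣ i ∣ → Divisible v k (q * fromℤ i) → Divisible v k q
  Divisible-cancelℤ {k} {q} (+ n) p∤n (divisible w z p∤w eq) =
    divisible (n ℕ.* w) z (∤-* v p∤n p∤w) (begin
      q * fromℕ (n ℕ.* w)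
        ≡⟨ cong (q *_) (trans (cong fromℤ (ℤ.pos-* n w)) (fromℤ-* (+ n) (+ w))) ⟩
      q * (fromℕ n * fromℕ w)
        ≡⟨ ℚ.*-assoc q (fromℕ n) (fromℕ w) ⟨
      q * fromℕ n * fromℕ w
        ≡⟨ eq ⟩
      fromℤ (+ (p ℕ.^ k) ℤ.* z) ∎)
  Divisible-cancelℤ {k} {q} -[1+ n ] p∤n dv = Divisible-cancelℤ (+ suc n) p∤n
    (subst (Divisible v k) (neg-neg q (fromℕ (suc n)))
      (Divisible-neg v dv))
    where
    neg-neg : ∀ q N → - (q * - N) ≡ q * N
    neg-neg = solve 2 (λ q N → :- (q :* :- N) := q :* N) refl

  Divisible-fromℕ : ∀ n → Divisible v 0 (fromℕ n)
  Divisible-fromℕ n = subst (Divisible v 0) (cong fromℤ (ℤ.*-identityˡ (+ n))) (Divisible-fromℤ v 0 (+ n))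

  Divisible⇒∣ : ∀ n → Divisible v 1 (fromℕ n) → p ∣ n
  Divisible⇒∣ n dv@(divisible w z p∤w _) =
    [ (λ p∣n → p∣n) , (λ p∣w → contradiction p∣w p∤w) ]′ (euclidsLemma n w pr
      (subst (p ∣_) (sym (Divisible⇒ℕ v dv))
        (subst₂ _∣_ (ℕ.*-identityʳ p) (sym (ℕ.*-assoc (p ℕ.^ 1) ℤ.∣ z ∣ 1)) (m∣m*n (ℤ.∣ z ∣ ℕ.* 1)))))

  record Unit (u : ℚ) : Set where
    field
      integral    : Divisible v 0 u
      indivisible : ¬ Divisible v 1 u

  -- Write u w = z with w prime to p. Then z is prime to p too, since otherwise p would divide u.
  -- Multiplying by w replaces u by the integer z, which can be cancelled.
  Divisible-cancelʳ : ∀ {k q u} → Unit u → Divisible v k (q * u) → Divisible v k q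
  Divisible-cancelʳ {k} {q} {u} unit dv with Unit.integral unit
  -- The factor `+ 1` is p ^ 0, from the integrality of u.
  ... | divisible w z p∤w eq = Divisible-cancelℤ (+ 1 ℤ.* z) p∤z
    (subst (Divisible v k) (trans (*-rotate (fromℕ w) q u) (cong (q *_) eq))
      (Divisible-* v (Divisible-fromℕ w) dv))
    where
    *-rotate : ∀ w q u → w * (q * u) ≡ q * (u * w)
    *-rotate = solve 3 (λ w q u → w :* (q :* u) := q :* (u :* w)) refl
    p∤z : p ∤ ℤ.∣ + 1 ℤ.* z ∣
    p∤z p∣z = Unit.indivisible unit (Divisible-cancelℤ (+ w) p∤w
      (subst (Divisible v 1) (sym eq) (∣↥⇒Divisible v (fromℤ (+ 1 ℤ.* z)) p∣z)))

  -- Congruences modulo powers of v.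

  infix 4 _≋[_]_
  record _≋[_]_ (q : ℚ) (k : ℕ) (r : ℚ) : Set where
    constructor congruent
    field difference : Divisible v k (q - r)

  open _≋[_]_ public

  ≡⇒≋ : ∀ {k q r} → q ≡ r → q ≋[ k ] r
  ≡⇒≋ {k} {q} refl = congruent (subst (Divisible v k) (sym (ℚ.+-inverseʳ q)) (Divisible-0 v k))

  ≋-sym : ∀ {k q r} → q ≋[ k ] r → r ≋[ k ] q
  ≋-sym {k} {q} {r} (congruent d) =
    congruent (subst (Divisible v k) (flip- q r) (Divisible-neg v d))
    where
    flip- : ∀ q r → - (q - r) ≡ r - q
    flip- = solve 2 (λ q r → :- (q :- r) := r :- q) refl

  ≋-trans : ∀ {k q r s} → q ≋[ k ] r → r ≋[ k ] s → q ≋[ k ] s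
  ≋-trans {k} {q} {r} {s} (congruent d) (congruent e) =
    congruent (subst (Divisible v k) (telescope q r s) (Divisible-+ v d e))
    where
    telescope : ∀ q r s → q - r + (r - s) ≡ q - s
    telescope = solve 3 (λ q r s → q :- r :+ (r :- s) := q :- s) refl

  ≋-weaken : ∀ {j k q r} → j ℕ.≤ k → q ≋[ k ] r → q ≋[ j ] r
  ≋-weaken j≤k (congruent d) = congruent (Divisible-weaken v j≤k d)

  ≋-Divisible : ∀ {k q r} → q ≋[ k ] r → Divisible v k r → Divisible v k q
  ≋-Divisible {k} {q} {r} (congruent d) e =
    subst (Divisible v k) (cancel q r) (Divisible-+ v d e)
    where
    cancel : ∀ q r → q - r + r ≡ q
    cancel = solve 2 (λ q r → q :- r :+ r := q) refl

  ≋-+ : ∀ {k q r q′ r′} → q ≋[ k ] r → q′ ≋[ k ] r′ → q + q′ ≋[ k ] r + r′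
  ≋-+ {k} {q} {r} {q′} {r′} (congruent d) (congruent d′) =
    congruent (subst (Divisible v k) (regroup q r q′ r′) (Divisible-+ v d d′))
    where
    regroup : ∀ q r q′ r′ → q - r + (q′ - r′) ≡ q + q′ - (r + r′)
    regroup = solve 4 (λ q r q′ r′ → q :- r :+ (q′ :- r′) := q :+ q′ :- (r :+ r′)) refl

  ≋-neg : ∀ {k q r} → q ≋[ k ] r → - q ≋[ k ] - r
  ≋-neg {k} {q} {r} (congruent d) =
    congruent (subst (Divisible v k) (distrib q r) (Divisible-neg v d))
    where
    distrib : ∀ q r → - (q - r) ≡ - q - - r
    distrib = solve 2 (λ q r → :- (q :- r) := :- q :- :- r) refl

  -- Congruent rationals may be non-integral, so one factor of each product is assumed integral: q
  -- q′ - r r′ = q (q′ - r′) + r′ (q - r).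
  ≋-* : ∀ {k q r q′ r′} → Divisible v 0 q → Divisible v 0 r′ →
    q ≋[ k ] r → q′ ≋[ k ] r′ → q * q′ ≋[ k ] r * r′
  ≋-* {k} {q} {r} {q′} {r′} q∈ℤᵥ r′∈ℤᵥ (congruent d) (congruent d′) =
    congruent (subst (Divisible v k) (regroup q r q′ r′)
      (Divisible-+ v (Divisible-* v q∈ℤᵥ d′) (Divisible-* v r′∈ℤᵥ d)))
    where
    regroup : ∀ q r q′ r′ → q * (q′ - r′) + r′ * (q - r) ≡ q * q′ - r * r′
    regroup = solve 4 (λ q r q′ r′ → q :* (q′ :- r′) :+ r′ :* (q :- r) := q :* q′ :- r :* r′) refl

  ^-integral : ∀ {q} → Divisible v 0 q → ∀ n → Divisible v 0 (q ^ n)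
  ^-integral q∈ℤᵥ zero    = Divisible-fromℕ 1
  ^-integral q∈ℤᵥ (suc n) = Divisible-* v q∈ℤᵥ (^-integral q∈ℤᵥ n)

  ≋-^ : ∀ {k q r} → Divisible v 0 q → Divisible v 0 r → q ≋[ k ] r → ∀ n → q ^ n ≋[ k ] r ^ n
  ≋-^ q∈ℤᵥ r∈ℤᵥ q≋r zero    = ≡⇒≋ refl
  ≋-^ q∈ℤᵥ r∈ℤᵥ q≋r (suc n) = ≋-* q∈ℤᵥ (^-integral r∈ℤᵥ n) q≋r (≋-^ q∈ℤᵥ r∈ℤᵥ q≋r n)

  ≋1⇒integral : ∀ {q} → q ≋[ 1 ] 1ℚ → Divisible v 0 q
  ≋1⇒integral q≋1 = ≋-Divisible (≋-weaken z≤n q≋1) (Divisible-fromℕ 1)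

  ≋1-^ : ∀ {q} → q ≋[ 1 ] 1ℚ → ∀ n → q ^ n ≋[ 1 ] 1ℚ
  ≋1-^ q≋1 zero    = ≡⇒≋ refl
  ≋1-^ q≋1 (suc n) = ≋-* (≋1⇒integral q≋1) (Divisible-fromℕ 1) q≋1 (≋1-^ q≋1 n)

  ≋⇒Unit : ∀ {u} n → p ∤ n → u ≋[ 1 ] fromℕ n → Unit u
  ≋⇒Unit n p∤n u≋n = record
    { integral    = ≋-Divisible (≋-weaken z≤n u≋n) (Divisible-fromℕ n)
    ; indivisible = λ du → p∤n (Divisible⇒∣ n (≋-Divisible (≋-sym u≋n) du))
    }

  ≋-cancelʳ : ∀ {k q r u} → Unit u → q * u ≋[ k ] r * u → q ≋[ k ] r
  ≋-cancelʳ {k} {q} {r} {u} unit (congruent d) =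
    congruent (Divisible-cancelʳ unit (subst (Divisible v k) (factor q r u) d))
    where
    factor : ∀ q r u → q * u - r * u ≡ (q - r) * u
    factor = solve 3 (λ q r u → q :* u :- r :* u := (q :- r) :* u) refl

  ≋-all⇒≡ : ∀ q r → (∀ k → q ≋[ k ] r) → q ≡ r
  ≋-all⇒≡ q r all = begin
    q           ≡⟨ insert q r ⟩
    q - r + r   ≡⟨ cong (_+ r) (Divisible-all⇒≡0 (q - r) λ k → difference (all k)) ⟩
    0ℚ + r      ≡⟨ ℚ.+-identityˡ r ⟩
    r           ∎
    where
    insert : ∀ q r → q ≡ q - r + r
    insert = solve 2 (λ q r → q := q :- r :+ r) refl

  -- Uniqueness of s-th roots among the elements congruent to 1: in q ^ s - r ^ s the cofactor of q
  -- - r is a unit, being congruent to s modulo v.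
  ≋-root : ∀ {k q r} s → p ∤ s → q ≋[ 1 ] 1ℚ → r ≋[ 1 ] 1ℚ → q ^ s ≋[ k ] r ^ s → q ≋[ k ] r
  ≋-root {k} {q} {r} s p∤s q≋1 r≋1 (congruent d) =
    congruent (Divisible-cancelʳ (≋⇒Unit s p∤s (geometric≋ s))
      (subst (Divisible v k) (sym (geometric-sum s)) d))
    where
    -- The sum of q ^ i r ^ (n - 1 - i) over i < n; each of its n summands is 1 modulo v.
    geometric : ℕ → ℚ
    geometric zero    = 0ℚ
    geometric (suc n) = q * geometric n + r ^ n

    geometric-sum : ∀ n → (q - r) * geometric n ≡ q ^ n - r ^ n
    geometric-sum zero    = ℚ.*-zeroʳ (q - r)
    geometric-sum (suc n) = trans (expand q r (geometric n) (r ^ n))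
      (trans (cong (λ t → q * t + (q - r) * r ^ n) (geometric-sum n)) (collect q r (q ^ n) (r ^ n)))
      where
      expand : ∀ q r g y → (q - r) * (q * g + y) ≡ q * ((q - r) * g) + (q - r) * y
      expand = solve 4 (λ q r g y → (q :- r) :* (q :* g :+ y) := q :* ((q :- r) :* g) :+ (q :- r) :* y) refl
      collect : ∀ q r x y → q * (x - y) + (q - r) * y ≡ q * x - r * y
      collect = solve 4 (λ q r x y → q :* (x :- y) :+ (q :- r) :* y := q :* x :- r :* y) refl

    geometric≋ : ∀ n → geometric n ≋[ 1 ] fromℕ n
    geometric≋ zero    = ≡⇒≋ refl
    geometric≋ (suc n) = ≋-trans
      (≋-+ (≋-* (≋1⇒integral q≋1) (Divisible-fromℕ n) q≋1 (geometric≋ n)) (≋1-^ r≋1 n))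
      (≡⇒≋ (trans (shape (fromℕ n)) (sym (fromℕ-suc n))))
      where
      shape : ∀ N → 1ℚ * N + 1ℚ ≡ 1ℚ + N
      shape = solve 1 (λ N → con 1ℚ :* N :+ con 1ℚ := con 1ℚ :+ N) refl

  -- Products of truncated series.

  -- The offset `j` counts the coefficients of `f` already dropped by the recursion; applications
  -- start from j = 0.
  conv-integral : ∀ {j} f g → (∀ n → Divisible v (n ℕ.+ j) (f n)) → (∀ n → Divisible v n (g n)) →
    ∀ n → Divisible v (n ℕ.+ j) (conv f g n)
  conv-integral {j} f g df dg zero    = subst (λ l → Divisible v l (f 0 * g 0)) (ℕ.+-identityʳ j)
    (Divisible-* v (df 0) (dg 0))
  conv-integral {j} f g df dg (suc n) = Divisible-+ v
    (subst (λ l → Divisible v l (f 0 * g (suc n))) (ℕ.+-comm j (suc n)) (Divisible-* v (df 0) (dg (suc n))))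
    (subst (λ l → Divisible v l (conv (λ k → f (suc k)) g n)) (ℕ.+-suc n j)
      (conv-integral (λ k → f (suc k)) g
        (λ k → subst (λ l → Divisible v l (f (suc k))) (sym (ℕ.+-suc k j)) (df (suc k))) dg n))

  partialSum-integral : ∀ {j} f → (∀ n → Divisible v j (f n)) → ∀ n → Divisible v j (partialSum f n)
  partialSum-integral {j} f df zero    = Divisible-0 v j
  partialSum-integral f df (suc n) = Divisible-+ v (partialSum-integral f df n) (df n)

  -- The product of the truncations exceeds the truncated product by terms f i * g k with i + k at
  -- least n, all divisible by v ^ (n + j). In the induction the new error is that of the shifted
  -- `f` plus `Sf * g n`.
  partialSum-conv : ∀ {j} f g → (∀ n → Divisible v (n ℕ.+ j) (f n)) → (∀ n → Divisible v n (g n)) →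
    ∀ n → partialSum f n * partialSum g n ≋[ n ℕ.+ j ] partialSum (conv f g) n
  partialSum-conv f g df dg zero    = ≡⇒≋ refl
  partialSum-conv {j} f g df dg (suc n) = congruent (subst (Divisible v (suc n ℕ.+ j)) regrouped
    (Divisible-+ v (difference ih) tail))
    where
    f′ = λ k → f (suc k)
    df′ : ∀ k → Divisible v (k ℕ.+ suc j) (f′ k)
    df′ k = subst (λ l → Divisible v l (f (suc k))) (sym (ℕ.+-suc k j)) (df (suc k))
    Sf = partialSum f′ n
    Sg = partialSum g n
    C  = partialSum (conv f′ g) n
    ih : Sf * Sg ≋[ suc n ℕ.+ j ] C
    ih = subst (λ l → Sf * Sg ≋[ l ] C) (ℕ.+-suc n j) (partialSum-conv f′ g df′ dg n)
    tail : Divisible v (suc n ℕ.+ j) (Sf * g n)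
    tail = subst (λ l → Divisible v l (Sf * g n)) (cong suc (ℕ.+-comm j n))
      (Divisible-* v (partialSum-integral f′ (λ k → Divisible-weaken v (ℕ.m≤n+m (suc j) k) (df′ k)) n) (dg n))
    regroup : ∀ s t c y z → s * t - c + s * z ≡ (y + s) * (t + z) - (y * (t + z) + c)
    regroup = solve 5 (λ s t c y z →
      s :* t :- c :+ s :* z := (y :+ s) :* (t :+ z) :- (y :* (t :+ z) :+ c)) refl
    regrouped : Sf * Sg - C + Sf * g n ≡
      partialSum f (suc n) * partialSum g (suc n) - partialSum (conv f g) (suc n)
    regrouped = trans (regroup Sf Sg C (f 0) (g n))
      (sym (cong₂ (λ s t → s * partialSum g (suc n) - t) (partialSum-shift f n) (partialSum-conv-suc f g n)))

  -- Truncated binomial series modulo powers of v.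

  module _ (x : ℚ) where

    S : ℚ → ℕ → ℚ
    S a = partialSum (term a x)

    -- A condition on the terms rather than on the exponent: by Vandermonde it is closed under
    -- addition, so multiples of b require no study of their denominators.
    Admissible : ℚ → Set
    Admissible a = ∀ n → Divisible v n (term a x n)

    admissible-+ : ∀ {a b} → Admissible a → Admissible b → Admissible (a + b)
    admissible-+ {a} {b} da db n = subst (Divisible v n) (term-vandermonde a b x n)
      (subst (λ l → Divisible v l (conv (term a x) (term b x) n)) (ℕ.+-identityʳ n)
        (conv-integral (term a x) (term b x)
          (λ k → subst (λ l → Divisible v l (term a x k)) (sym (ℕ.+-identityʳ k)) (da k)) db n))

    S-integral : ∀ {a} → Admissible a → ∀ n → Divisible v 0 (S a n)
    S-integral {a} da = partialSum-integral (term a x) λ k → Divisible-weaken v z≤n (da k)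

    S-+ : ∀ {a b} → Admissible a → Admissible b → ∀ n → S a n * S b n ≋[ n ] S (a + b) n
    S-+ {a} {b} da db n = ≋-trans
      (subst (λ l → S a n * S b n ≋[ l ] partialSum (conv (term a x) (term b x)) n) (ℕ.+-identityʳ n)
        (partialSum-conv (term a x) (term b x)
          (λ k → subst (λ l → Divisible v l (term a x k)) (sym (ℕ.+-identityʳ k)) (da k)) db n))
      (≡⇒≋ (partialSum-cong (term-vandermonde a b x) n))

    suc-multiple : ∀ i a → a + fromℕ i * a ≡ fromℕ (suc i) * a
    suc-multiple i a = trans (factor (fromℕ i) a) (cong (_* a) (sym (fromℕ-suc i)))
      where
      factor : ∀ N a → a + N * a ≡ (1ℚ + N) * a
      factor = solve 2 (λ N a → a :+ N :* a := (con 1ℚ :+ N) :* a) refl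

    module _ (dx : Divisible v 1 x) where

      admissible : ∀ b → p ∤ ↧ₙ b → Admissible b
      admissible b p∤d n = Divisible-* v (Divisible-binom v b n p∤d) (Divisible-^ v dx n)

      admissible-multiple : ∀ {a} → Admissible a → ∀ i → Admissible (fromℕ i * a)
      admissible-multiple {a} da zero    = subst Admissible (sym (ℚ.*-zeroˡ a)) (admissible 0ℚ (p∤1 v))
      admissible-multiple {a} da (suc i) = subst Admissible (suc-multiple i a)
        (admissible-+ da (admissible-multiple da i))

      S-^ : ∀ {a} → Admissible a → ∀ i n → S a (suc n) ^ i ≋[ suc n ] S (fromℕ i * a) (suc n)
      -- The zeroth power is the series with exponent 0, whose truncation is 1 only when nonempty.
      S-^ {a} da zero    n = ≡⇒≋ (sym (trans (cong (λ c → S c (suc n)) (ℚ.*-zeroˡ a)) (sum-term-0 x n)))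
      S-^ {a} da (suc i) n = ≋-trans
        (≋-* (S-integral da (suc n)) (S-integral (admissible-multiple da i) (suc n)) (≡⇒≋ refl) (S-^ da i n))
        (≋-trans (S-+ da (admissible-multiple da i) (suc n))
          (≡⇒≋ (cong (λ c → S c (suc n)) (suc-multiple i a))))

      1+x-^ : ∀ i n → (1ℚ + x) ^ i ≋[ suc (suc n) ] S (fromℕ i) (suc (suc n))
      1+x-^ i n = ≋-trans (≡⇒≋ (cong (_^ i) (sym (sum-term-1 x n))))
        (≋-trans (S-^ (admissible 1ℚ (p∤1 v)) i (suc n))
          (≡⇒≋ (cong (λ c → S c (suc (suc n))) (ℚ.*-identityʳ (fromℕ i)))))

      1+x≋1 : 1ℚ + x ≋[ 1 ] 1ℚ
      1+x≋1 = congruent (subst (Divisible v 1) (cancel x) dx)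
        where
        cancel : ∀ x → x ≡ 1ℚ + x - 1ℚ
        cancel = solve 1 (λ x → x := con 1ℚ :+ x :- con 1ℚ) refl

      -- The constant term is 1 and v divides every later term.
      S≋1 : ∀ {a} → Admissible a → ∀ n → S a (suc n) ≋[ 1 ] 1ℚ
      S≋1 {a} da n = ≋-trans (≡⇒≋ (partialSum-shift (term a x) n)) (≋-trans
        (≋-+ {q = 1ℚ} {r = 1ℚ} {q′ = T} {r′ = 0ℚ} (≡⇒≋ refl) (congruent (subst (Divisible v 1) (sym (ℚ.+-identityʳ T))
          (partialSum-integral (λ k → term a x (suc k)) (λ k → Divisible-weaken v (s≤s z≤n) (da (suc k))) n))))
        (≡⇒≋ refl))
        where T = partialSum (λ k → term a x (suc k)) n

      admissible-ℕ : ∀ i → Admissible (fromℕ i)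
      admissible-ℕ i = admissible (fromℕ i) (p∤1 v)

      power-congruence : ∀ {b} s k m → p ∤ ↧ₙ b → fromℕ s * b + fromℕ k ≡ fromℕ m → ∀ n →
        S b (suc (suc n)) ^ s * (1ℚ + x) ^ k ≋[ suc (suc n) ] (1ℚ + x) ^ m
      power-congruence {b} s k m p∤d eq n = ≋-trans
        (≋-* (^-integral (S-integral db N) s) (S-integral (admissible-ℕ k) N)
          (S-^ db s (suc n)) (1+x-^ k n))
        (≋-trans (S-+ (admissible-multiple db s) (admissible-ℕ k) N)
          (≋-trans (≡⇒≋ (cong (λ c → S c N) eq)) (≋-sym (1+x-^ m n))))
        where
        N  = suc (suc n)
        db = admissible b p∤d

      -- Passing to the limit in `power-congruence` gives a congruence between two fixed rationals
      -- modulo every power of v, hence an equality.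
      root-equation : ∀ {b} s k m → p ∤ ↧ₙ b → fromℕ s * b + fromℕ k ≡ fromℕ m → ∀ c →
        (∀ j → ∃[ N ] ∀ n → N ℕ.≤ n → S b n ≋[ j ] c) → c ^ s * (1ℚ + x) ^ k ≡ (1ℚ + x) ^ m
      root-equation {b} s k m p∤d eq c limit = ≋-all⇒≡ (c ^ s * (1ℚ + x) ^ k) ((1ℚ + x) ^ m) λ j →
        let N , close = limit j
            -- The summand N puts the truncation in the range of the limit; the summand j makes the
            -- modulus at least v ^ j.
            n         = N ℕ.+ j
            S≋c       = close (suc (suc n)) (ℕ.m≤n⇒m≤1+n (ℕ.m≤n⇒m≤1+n (ℕ.m≤m+n N j)))
            S∈ℤᵥ      = S-integral (admissible b p∤d) (suc (suc n))
            c∈ℤᵥ      = ≋-Divisible (≋-weaken z≤n (≋-sym S≋c)) S∈ℤᵥ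
        in ≋-trans
          (≋-* (^-integral c∈ℤᵥ s) (^-integral (≋1⇒integral 1+x≋1) k)
            (≋-^ c∈ℤᵥ S∈ℤᵥ (≋-sym S≋c) s) (≡⇒≋ refl))
          (≋-weaken (ℕ.m≤n⇒m≤1+n (ℕ.m≤n⇒m≤1+n (ℕ.m≤n+m j N))) (power-congruence s k m p∤d eq n))

      1+x-^-unit : ∀ k → Unit ((1ℚ + x) ^ k)
      1+x-^-unit k = ≋⇒Unit 1 (p∤1 v) (≋1-^ 1+x≋1 k)

      -- Cancelling the unit (1 + x) ^ k leaves S ^ s ≡ d ^ s. As S and d are both 1 modulo v,
      -- uniqueness of roots applies.
      S≋root : ∀ {b} s k m → p ∤ s → p ∤ ↧ₙ b → fromℕ s * b + fromℕ k ≡ fromℕ m → ∀ d →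
        d ≋[ 1 ] 1ℚ → d ^ s * (1ℚ + x) ^ k ≡ (1ℚ + x) ^ m → ∀ n →
        S b (suc (suc n)) ≋[ suc (suc n) ] d
      S≋root {b} s k m p∤s p∤d eq d d≋1 root n = ≋-root s p∤s (S≋1 (admissible b p∤d) (suc n)) d≋1
        (≋-cancelʳ (1+x-^-unit k) (≋-trans (power-congruence s k m p∤d eq n) (≡⇒≋ (sym root))))

      -- For odd s, both c ^ s and (- c) ^ s = - (c ^ s) are congruent to 1, so 2 ≡ 0
      -- and the two signs of c agree modulo v.
      root-sign : ∀ s k m c → c ^ s * (1ℚ + x) ^ k ≡ (1ℚ + x) ^ m → - c ≋[ 1 ] 1ℚ →
        ∃[ d ] (d ≋[ 1 ] 1ℚ × d ^ s * (1ℚ + x) ^ k ≡ (1ℚ + x) ^ m)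
      root-sign s k m c root -c≋1 with neg-^ c s
      ... | inj₁ even = - c , -c≋1 , trans (cong (_* (1ℚ + x) ^ k) even) root
      ... | inj₂ odd  = c , ≋-trans (≡⇒≋ (sym (neg-involutive c))) (≋-trans (≋-neg -c≋1) -1≋1) , root
        where
        cˢ≋1 : c ^ s ≋[ 1 ] 1ℚ
        cˢ≋1 = ≋-cancelʳ (1+x-^-unit k) (≋-trans (≡⇒≋ root) (≋-trans (≋1-^ 1+x≋1 m)
          (≋-sym (≋-trans (≡⇒≋ (ℚ.*-identityˡ ((1ℚ + x) ^ k))) (≋1-^ 1+x≋1 k)))))
        -1≋1 : - 1ℚ ≋[ 1 ] 1ℚ
        -1≋1 = ≋-trans (≋-sym (≋-neg cˢ≋1)) (≋-trans (≡⇒≋ (sym odd)) (≋1-^ -c≋1 s))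

-- Transfer from one prime to another.

-- A negative numerator is moved to the other side as k, so that both powers of 1 + x have natural
-- exponents.
rational-exponent : ∀ b → ∃[ k ] ∃[ m ] fromℕ (↧ₙ b) * b + fromℕ k ≡ fromℕ m
rational-exponent b with ↥ b | ↥≡*↧ b
... | + m      | eq = 0 , m , trans (ℚ.+-identityʳ (fromℕ (↧ₙ b) * b)) (trans (ℚ.*-comm (fromℕ (↧ₙ b)) b) eq)
... | -[1+ m ] | eq = suc m , 0 , trans
  (cong (_+ fromℕ (suc m)) (trans (ℚ.*-comm (fromℕ (↧ₙ b)) b) eq)) (ℚ.+-inverseˡ (fromℕ (suc m)))

rational-value : ∀ b x v′ (∣x∣′<1 : ∣ x ∣[ v′ ] < 1ℚ) (∣b∣′≤1 : ∣ b ∣[ v′ ] ≤ 1ℚ) →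
  ∀ c → F v′ b x ∣x∣′<1 ∣b∣′≤1 ≈ ι c →
  ∀ v (∣x∣<1 : ∣ x ∣[ v ] < 1ℚ) (∣b∣≤1 : ∣ b ∣[ v ] ≤ 1ℚ) →
  ∣ c - 1ℚ ∣[ v ] < 1ℚ ⊎ ∣ - c - 1ℚ ∣[ v ] < 1ℚ → IsRational (F v b x ∣x∣<1 ∣b∣≤1)
rational-value b x v′ ∣x∣′<1 ∣b∣′≤1 c F≈c v ∣x∣<1 ∣b∣≤1 ±c≋1 =
  let k , m , eq = rational-exponent b
      root = root-equation v′ x (∣<1⇒Divisible v′ x ∣x∣′<1) (↧ₙ b) k m (∣≤1⇒∤↧ v′ b ∣b∣′≤1) eq c
        -- Convergence with ε = p ^ (- j) at v′ is read as a congruence modulo v′ ^ j.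
        λ j → let N , close = F≈c (pᵃ/pᵇ v′ 0 j) (pᵃ/pᵇ>0 v′ 0 j)
              in N , λ n N≤n → congruent (<p⁻ᵏ⇒Divisible v′ (seq (F v′ b x ∣x∣′<1 ∣b∣′≤1) n - c) (close n N≤n))
      d , d≋1 , root′ = choose k m root ±c≋1
  -- `small` asks for an exponent at least the denominator of ε; the additional two guarantee a
  -- truncation of length at least two.
  in d , λ ε ε>0 → suc (suc (↧ₙ ε)) , λ { (suc (suc n)) (s≤s (s≤s ε≤n)) →
    small v ε ε>0 (ℕ.m≤n⇒m≤1+n (ℕ.m≤n⇒m≤1+n ε≤n))
      (difference (S≋root v x dx (↧ₙ b) k m p∤d p∤d eq d d≋1 root′ n)) }
  where
  dx  = ∣<1⇒Divisible v x ∣x∣<1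
  -- Since the exponent s is the denominator of b, this fact serves twice: it makes the binomial
  -- coefficients integral and s a unit at v.
  p∤d = ∣≤1⇒∤↧ v b ∣b∣≤1

  choose : ∀ k m → c ^ ↧ₙ b * (1ℚ + x) ^ k ≡ (1ℚ + x) ^ m →
    ∣ c - 1ℚ ∣[ v ] < 1ℚ ⊎ ∣ - c - 1ℚ ∣[ v ] < 1ℚ →
    ∃[ d ] (_≋[_]_ v d 1 1ℚ × d ^ ↧ₙ b * (1ℚ + x) ^ k ≡ (1ℚ + x) ^ m)
  choose k m root (inj₁ c≋1)  = c , congruent (∣<1⇒Divisible v (c - 1ℚ) c≋1) , root
  choose k m root (inj₂ -c≋1) =
    root-sign v x dx (↧ₙ b) k m c root (congruent (∣<1⇒Divisible v (- c - 1ℚ) -c≋1))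

theorem4p7 : (r s : ℤ) .{{s≢0 : NonZero s}} (x : ℚ) →
    let b = fromℤ r ÷ fromℤ s in
    (v′ : V) (∣x∣′<1 : ∣ x ∣[ v′ ] < 1ℚ) (∣b∣′≤1 : ∣ b ∣[ v′ ] ≤ 1ℚ) →
    (c : ℚ) → F v′ b x ∣x∣′<1 ∣b∣′≤1 ≈ ι c →
    (v : V) (∣x∣<1 : ∣ x ∣[ v ] < 1ℚ) (∣b∣≤1 : ∣ b ∣[ v ] ≤ 1ℚ) →
    ∣ c - 1ℚ ∣[ v ] < 1ℚ ⊎ ∣ - c - 1ℚ ∣[ v ] < 1ℚ →
    IsRational (F v b x ∣x∣<1 ∣b∣≤1)
-- The fraction r / s need not be reduced: the argument uses the lowest terms of its value b.
theorem4p7 r s x = rational-value (fromℤ r ÷ fromℤ s) x
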